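{- There is an algorithm that, given a finite digraph $G$ with $n$ vertices, computes the cycle rank $r(G)$ in time and space $O^*(2^n)$.
   Context: The notation $O^*(g(n))$ means $O(g(n)\cdot n^{O(1)})$, i.e. factors polynomial in $n$ are suppressed. A digraph $G=(V,E)$ has a finite vertex set $V$ and edge set $E\subseteq V^2$; loops $(v,v)$ are allowed. A strongly connected component is trivial if the subdigraph induced by it has no edges, and $G$ is acyclic if all of its strongly connected components are trivial (so a digraph with a loop is not acyclic). $G-v$ denotes the subdigraph induced by $V\setminus\{v\}$. The cycle rank $r(G)$ is defined inductively: if $G$ is acyclic, then $r(G)=0$; if $G$ is strongly connected and $E\neq\emptyset$, then $r(G)=1+\min_{v\in V} r(G-v)$; if $G$ is not strongly connected, then $r(G)$ is the maximum of the cycle ranks of the subdigraphs induced by the strongly connected components of $G$. -}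

module Defs where

open import Data.Bool.Base using (Bool; T; if_then_else_)
open import Data.Fin.Base using (Fin; zero)
open import Data.Fin.Subset using (Subset; _∈_; _-_; ⊤)
open import Data.List.Base using (List; []; _∷_; cartesianProductWith; allFin; map)
open import Data.Nat.Base using (ℕ; zero; suc; _+_; _∸_; _*_; _/_; _^_; _≤_; _⊔_)
open import Data.Nat.ListAction using (sum)
open import Data.Nat.Logarithm using (⌊log₂_⌋)
open import Data.Product.Base using (_×_; ∃-syntax)
open import Data.Vec.Base as Vec using (Vec; lookup; replicate; _[_]≔_)
open import Function.Bundles using (_⇔_)
open import Relation.Binary.Construct.Closure.ReflexiveTransitive using (Star)
open import Relation.Binary.PropositionalEquality.Core using (_≡_; _≢_)
open import Relation.Nullary.Negation.Core using (¬_)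

IsMin : {A : Set} → (A → Set) → (A → ℕ) → ℕ → Set
IsMin P f m = (∀ a → P a → m ≤ f a) × (∃[ a ] P a × f a ≡ m)

IsMax : {A : Set} → (A → Set) → (A → ℕ) → ℕ → Set
IsMax P f m = (∀ a → P a → f a ≤ m) × (∃[ a ] P a × f a ≡ m)

-- A digraph on the vertex set Fin n, loops allowed.

Digraph : ℕ → Set
Digraph n = Fin n → Fin n → Bool

-- Induced subdigraphs of G are represented by their vertex sets U, so that
-- G[U] - v is G[U - v] and an induced subdigraph of G[U] is again some G[W].

module _ {n : ℕ} (G : Digraph n) where

  Edge : Subset n → Fin n → Fin n → Set
  Edge U u v = u ∈ U × v ∈ U × T (G u v)

  Reachable : Subset n → Fin n → Fin n → Set
  Reachable U = Star (Edge U)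

  HasEdge : Subset n → Set
  HasEdge U = ∃[ u ] ∃[ v ] Edge U u v

  StronglyConnected : Subset n → Set
  StronglyConnected U = ∀ {u v} → u ∈ U → v ∈ U → Reachable U u v

  -- C is the vertex set of a strongly connected component of G[U], that is,
  -- an equivalence class of mutual reachability in G[U].

  IsSCC : Subset n → Subset n → Set
  IsSCC U C =
    ∃[ u ] u ∈ U × (∀ v → v ∈ C ⇔ (Reachable U u v × Reachable U v u))

  Acyclic : Subset n → Set
  Acyclic U = ∀ C → IsSCC U C → ¬ HasEdge C

  -- CycleRankOn U r says that r (G[U]) = r.  The values of f outside the
  -- vertices of U, respectively outside the components of G[U], play no role.

  data CycleRankOn : Subset n → ℕ → Set where

    acyclic : ∀ {U} → Acyclic U → CycleRankOn U 0

    strong : ∀ {U m} → StronglyConnected U → HasEdge U →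
             (f : Fin n → ℕ) → (∀ v → v ∈ U → CycleRankOn (U - v) (f v)) →
             IsMin (_∈ U) f m →
             CycleRankOn U (suc m)

    components : ∀ {U m} → ¬ StronglyConnected U →
                 (f : Subset n → ℕ) → (∀ C → IsSCC U C → CycleRankOn C (f C)) →
                 IsMax (IsSCC U) f m →
                 CycleRankOn U m

  CycleRank : ℕ → Set
  CycleRank = CycleRankOn ⊤

-- Random access machines, with structured control flow and the logarithmic
-- cost criterion.  A program has a fixed number k of registers besides the
-- memory; memory is addressed through registers.

data Op : Set where
  add monus mul div : Op

-- Division by zero yields zero.

⟦_⟧ : Op → ℕ → ℕ → ℕ
⟦ add   ⟧ a b       = a + b
⟦ monus ⟧ a b       = a ∸ b
⟦ mul   ⟧ a b       = a * b
⟦ div   ⟧ a zero    = 0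
⟦ div   ⟧ a (suc b) = a / suc b

data Instr (k : ℕ) : Set where
  const : (x : Fin k) (c : ℕ) → Instr k
  op    : (x : Fin k) (o : Op) (y z : Fin k) → Instr k
  load  : (x y : Fin k) → Instr k
  store : (x y : Fin k) → Instr k

infixr 5 _⨾_

data Cmd (k : ℕ) : Set where
  instr   : Instr k → Cmd k
  skip    : Cmd k
  _⨾_     : Cmd k → Cmd k → Cmd k
  ifnz    : (x : Fin k) → Cmd k → Cmd k → Cmd k
  whilenz : (x : Fin k) → Cmd k → Cmd k

-- The memory consists of the cells 0 , … , length - 1.  Cells beyond the end
-- read as 0, and writing to one of them first extends the memory by zeros.

Memory : Set
Memory = List ℕ

read : Memory → ℕ → ℕ
read []      a       = 0
read (v ∷ M) zero    = v
read (v ∷ M) (suc a) = read M a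

write : Memory → ℕ → ℕ → Memory
write []      zero    w = w ∷ []
write []      (suc a) w = 0 ∷ write [] a w
write (v ∷ M) zero    w = w ∷ M
write (v ∷ M) (suc a) w = v ∷ write M a w

record State (k : ℕ) : Set where
  constructor ⟨_,_⟩
  field
    regs : Vec ℕ k
    mem  : Memory

open State public

reg : ∀ {k} → State k → Fin k → ℕ
reg s x = lookup (regs s) x

setReg : ∀ {k} → State k → Fin k → ℕ → State k
setReg s x v = ⟨ regs s [ x ]≔ v , mem s ⟩

exec : ∀ {k} → Instr k → State k → State k
exec (const x c)  s = setReg s x c
exec (op x o y z) s = setReg s x (⟦ o ⟧ (reg s y) (reg s z))
exec (load x y)   s = setReg s x (read (mem s) (reg s y))
exec (store x y)  s = ⟨ regs s , write (mem s) (reg s x) (reg s y) ⟩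

-- Number of binary digits, where 0 has one digit.

bits : ℕ → ℕ
bits v = suc ⌊log₂ v ⌋

-- An instruction is charged for its operands and for the addresses it uses.

cost : ∀ {k} → Instr k → State k → ℕ
cost (const x c)  s = bits c
cost (op x o y z) s = bits (reg s y) + bits (reg s z)
cost (load x y)   s = bits (reg s y) + bits (read (mem s) (reg s y))
cost (store x y)  s = bits (reg s x) + bits (reg s y)

-- Every memory cell up to the highest address written so far is counted, even
-- if it was never accessed.

size : ∀ {k} → State k → ℕ
size s = Vec.sum (Vec.map bits (regs s)) + sum (map bits (mem s))

-- Run c s s′ : started in state s, the command c halts in state s′.

data Run {k : ℕ} : Cmd k → State k → State k → Set where

  instr : ∀ {i s} → Run (instr i) s (exec i s)

  skip : ∀ {s} → Run skip s s

  _⨾_ : ∀ {c d s s′ s″} → Run c s s′ → Run d s′ s″ → Run (c ⨾ d) s s″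

  ifTrue : ∀ {x c d s s′} → reg s x ≢ 0 → Run c s s′ → Run (ifnz x c d) s s′

  ifFalse : ∀ {x c d s s′} → reg s x ≡ 0 → Run d s s′ → Run (ifnz x c d) s s′

  whileTrue : ∀ {x c s s′ s″} → reg s x ≢ 0 →
              Run c s s′ → Run (whilenz x c) s′ s″ → Run (whilenz x c) s s″

  whileFalse : ∀ {x c s} → reg s x ≡ 0 → Run (whilenz x c) s s

time : ∀ {k} {c : Cmd k} {s s′} → Run c s s′ → ℕ
time (instr {i} {s})               = cost i s
time skip                          = 1
time (p ⨾ q)                       = time p + time q
time (ifTrue {x} {s = s} _ p)      = bits (reg s x) + time p
time (ifFalse {x} {s = s} _ p)     = bits (reg s x) + time p
time (whileTrue {x} {s = s} _ p q) = bits (reg s x) + time p + time q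
time (whileFalse {x} {s = s} _)    = bits (reg s x)

-- The maximal size of a state occurring during the run.

space : ∀ {k} {c : Cmd k} {s s′} → Run c s s′ → ℕ
space (instr {i} {s})      = size s ⊔ size (exec i s)
space (skip {s})           = size s
space (p ⨾ q)              = space p ⊔ space q
space (ifTrue _ p)         = space p
space (ifFalse _ p)        = space p
space (whileTrue _ p q)    = space p ⊔ space q
space (whileFalse {s = s} _) = size s

-- The input is placed in memory and all registers are initially 0; the output
-- is left in the first register.

record Program : Set where
  field
    extra : ℕ
    code  : Cmd (suc extra)

open Program public

initial : ∀ {k} → List ℕ → State k
initial input = ⟨ replicate _ 0 , input ⟩

record Computes (P : Program) (input : List ℕ) (output t m : ℕ) : Set where
  field
    final   : State (suc (extra P))
    run     : Run (code P) (initial input) final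
    correct : reg final zero ≡ output
    inTime  : time run ≤ t
    inSpace : space run ≤ m

-- The number of vertices, followed by the adjacency matrix row by row.

encode : ∀ {n} → Digraph n → List ℕ
encode {n} G =
  n ∷ cartesianProductWith (λ u v → if G u v then 1 else 0) (allFin n) (allFin n)

infix 4 _∈O_ _∈O*_

_∈O_ : (ℕ → ℕ) → (ℕ → ℕ) → Set
f ∈O g = ∃[ c ] ∃[ n₀ ] (∀ n → n₀ ≤ n → f n ≤ c * g n)

_∈O*_ : (ℕ → ℕ) → (ℕ → ℕ) → Set
f ∈O* g = ∃[ d ] f ∈O (λ n → g n * n ^ d)

{-# OPTIONS --safe #-}
-- Two tables indexed by the vertex sets U, encoded as bit masks, are filled in
-- increasing order of the masks.  The first one stores reachability in G[U]: a
-- walk from i to some j ≠ i can be cut at its last visit to i, and what follows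
-- is an edge leaving i and a walk in G[U - i].  The second one stores r (G[U]):
-- its recursive definition refers to the sets U - v if G[U] is strongly connected,
-- and otherwise to the components of G[U], which are read off the first table and
-- are proper subsets of U; in both cases the masks are smaller than that of U.
--
-- Each entry is the value of a fixed expression built from arithmetic, memory
-- accesses and folds over i < n.  Evaluating such an expression takes polynomially
-- many instructions on numbers with polynomially many bits, and there are
-- 2 ^ n * (n * n + 1) entries.

module Submission where

open import Defs
open import Data.Nat.Base using (ℕ; _^_)
open import Data.Product.Base using (_×_; ∃-syntax; Σ-syntax)

open import Data.Bool.Base using (Bool; true; false; T; if_then_else_)
open import Data.Fin.Base using (Fin; zero; suc; toℕ; fromℕ<)
open import Data.Fin.Properties using (toℕ<n; toℕ-fromℕ<; toℕ-injective) renaming (_≟_ to _≟ᶠ_)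
open import Data.Fin.Subset using (Subset; Side; inside; outside; _∈_; _∉_; _⊆_; _-_; ⊤; ∣_∣; ⁅_⁆)
open import Data.Fin.Subset.Properties
  using (_∈?_; p─⊥≡p; drop-there; drop-∷-⊆; ⊆⊤; x∈p∧x≢y⇒x∈p-y; p─q⊆p; ⊆-antisym;
         p⊆q⇒∣p∣≤∣q∣; x∈p⇒∣p-x∣<∣p∣; ∣p∣≤n)
open import Data.List.Base
  using (List; []; _∷_; _++_; length; map; filter; tabulate; allFin; cartesianProductWith)
open import Data.List.Extrema.Nat
  using (argmax; argmin; argmax-all; argmin-all; f[xs]≤f[argmax]; f[argmin]≤f[xs])
open import Data.List.Membership.Propositional.Properties using (∈-filter⁺; ∈-allFin)
open import Data.List.Properties
  using (length-++; length-map; length-tabulate; ++-assoc; ++-identityʳ)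
open import Data.List.Relation.Unary.All as All using (All; []; _∷_)
open import Data.List.Relation.Unary.All.Properties using (++⁺; map⁺; all-filter)
open import Data.Nat.Base hiding (ℕ; _^_)
open import Data.Nat.DivMod
  using (_%_; m/n≤m; m%n≡m∸m/n*n; [m+kn]%n≡m%n; m*n%n≡0; m<n⇒m%n≡m; n/1≡n; m*n/n≡m;
         m<n⇒m/n≡0; +-distrib-/; m/n/o≡m/[n*o])
open import Data.Nat.ListAction using (sum)
open import Data.Nat.Logarithm using (⌊log₂⌋-mono-≤; ⌊log₂[2^n]⌋≡n)
open import Data.Nat.Properties
open import Data.Nat.Solver using (module +-*-Solver)
open import Data.Product.Base using (_,_; proj₁; proj₂)
open import Data.Sum.Base using (_⊎_; inj₁; inj₂)
open import Data.Vec.Base as Vec using (Vec; []; _∷_; lookup; here; there)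
open import Data.Vec.Properties
  using (lookup∘update; lookup∘update′; lookup-replicate; lookup∘tabulate; lookup⇒[]=; []=⇒lookup)
open import Function.Base using (_∘_; id)
open import Function.Bundles using (_⇔_; mk⇔; Equivalence)
open import Relation.Binary.Construct.Closure.ReflexiveTransitive as Star using (ε; _◅_; _◅◅_)
open import Relation.Binary.Definitions using (tri<; tri≈; tri>)
open import Relation.Binary.PropositionalEquality
open import Relation.Nullary using (¬_; Dec; yes; no; does; contradiction)
open import Relation.Nullary.Decidable using (dec-true)

open Equivalence using (to; from)

-- Expressions and their compilation

-- Every fold ranges over the numbers below order.

-- Under the logarithmic cost criterion every value needs a size bound, and values read from memory
-- feed later ones. Two widths break this circle. Cells stay at most `2 ^ q` with `q` linear in `n`,
-- because table entries are truth values or ranks, and this holds whatever the memory contains.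
-- Registers may reach `2 ^ W`, where `W` is computed from `n` and `q` by recursion on the
-- expressions. So sizes do not accumulate over exponentially many entries, and the time is the
-- number of steps times one fixed unit.
--
-- Expressions have no conditional: both sides of a case distinction are always evaluated, even
-- where an address is meaningless. Truth is therefore being nonzero, and a product acts as a
-- guarded conjunction whose second factor matters only if the first is nonzero.
--
-- Entries are only ever appended, at the address equal to the current length. The memory thus has
-- no gaps, and an entry recovers its table index from its own address.

data Exp : ℕ → Set where
  var   : ∀ {m} → Fin m → Exp m
  lit   : ∀ {m} → ℕ → Exp m
  order : ∀ {m} → Exp m
  bin   : ∀ {m} → Op → Exp m → Exp m → Exp m
  cell  : ∀ {m} → Exp m → Exp m
  fold  : ∀ {m} → Op → ℕ → Exp (suc m) → Exp m

big : Op → ℕ → ℕ → (ℕ → ℕ) → ℕ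
big o c zero    f = c
big o c (suc n) f = ⟦ o ⟧ (big o c n f) (f n)

eval : ∀ {m} → Exp m → ℕ → Memory → Vec ℕ m → ℕ
eval (var x)      n M ρ = lookup ρ x
eval (lit c)      n M ρ = c
eval order        n M ρ = n
eval (bin o a b)  n M ρ = ⟦ o ⟧ (eval a n M ρ) (eval b n M ρ)
eval (cell a)     n M ρ = read M (eval a n M ρ)
eval (fold o c a) n M ρ = big o c n (λ i → eval a n M (i ∷ ρ))

length-snoc : ∀ (M : Memory) v → length (M ++ v ∷ []) ≡ suc (length M)
length-snoc M v = trans (length-++ M) (+-comm (length M) 1)

-- The only variable of `E` is the address of the cell about to be appended.
emit : Exp 1 → ℕ → ℕ → Memory → Memory
emit E n zero    M = M
emit E n (suc S) M = emit E n S (M ++ eval E n M (length M ∷ []) ∷ [])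

-- An exponent of two bounding the value, with the widths of all subexpressions as summands, so that
-- it bounds intermediate values too. This explains the address width in `cell`, and `suc n` instead
-- of `n` in `fold`: the extra copy covers the body.
width : ∀ {m} → ℕ → ℕ → Exp m → ℕ
width n q (var x)      = q
width n q (lit c)      = c
width n q order        = q
width n q (bin o a b)  = suc (width n q a + width n q b)
width n q (cell a)     = q + width n q a
width n q (fold o c a) = c + suc n * suc (width n q a)

-- Counts instructions and loop tests. The sums are nested like the sequencing in `compile`, so that
-- the counts agree by computation. A fold has four initial instructions, one test and three
-- instructions per round besides its body, and one final test.
steps : ∀ {m} → ℕ → Exp m → ℕ
steps n (var x)      = 2
steps n (lit c)      = 1
steps n order        = 2
steps n (bin o a b)  = steps n a + (steps n b + 1)
steps n (cell a)     = steps n a + 1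
steps n (fold o c a) = 1 + (1 + (1 + (1 + (n * suc (steps n a + 3) + 1))))

temps : ∀ {m} → Exp m → ℕ
temps (var x)      = 0
temps (lit c)      = 0
temps order        = 0
temps (bin o a b)  = suc (temps a + temps b)
temps (cell a)     = temps a
temps (fold o c a) = 3 + temps a

inputLength : ∀ {m} → Exp m
inputLength = bin add (lit 1) (bin mul order order)

-- With the length of the memory as its variable, this reads the rank of the full vertex set, whose
-- mask is the largest and whose entry is the last.
lastCell : Exp 1
lastCell = cell (bin monus (var zero) (lit 1))

-- Sizes of values, and reading and writing memory

m≤2^m : ∀ m → m ≤ 2 ^ m
m≤2^m m = <⇒≤ (n<2^n m)
  where
  n<2^n : ∀ n → n < 2 ^ n
  n<2^n zero    = s≤s z≤n
  n<2^n (suc n) = begin-strict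
    suc n         ≤⟨ n<2^n n ⟩
    2 ^ n         <⟨ m<m+n (2 ^ n) (m^n>0 2 n) ⟩
    2 ^ n + 2 ^ n ≡⟨ cong (2 ^ n +_) (+-identityʳ (2 ^ n)) ⟨
    2 ^ suc n     ∎
    where open ≤-Reasoning

2^-mono : ∀ {a b} → a ≤ b → 2 ^ a ≤ 2 ^ b
2^-mono = ^-monoʳ-≤ 2

-- One exponent serves all operations: `a + b` suffices for products, the additional one is the
-- carry of a sum, and the other two never exceed their first argument.
op-bound : ∀ o {x y a b} → x ≤ 2 ^ a → y ≤ 2 ^ b → ⟦ o ⟧ x y ≤ 2 ^ suc (a + b)
op-bound add {x} {y} {a} {b} x≤ y≤ = begin
  x + y                     ≤⟨ +-mono-≤ (≤-trans x≤ (2^-mono (m≤m+n a b))) (≤-trans y≤ (2^-mono (m≤n+m b a))) ⟩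
  2 ^ (a + b) + 2 ^ (a + b) ≡⟨ cong (2 ^ (a + b) +_) (+-identityʳ (2 ^ (a + b))) ⟨
  2 ^ suc (a + b)           ∎
  where open ≤-Reasoning
op-bound monus {x} {y} {a} {b} x≤ y≤ =
  ≤-trans (m∸n≤m x y) (≤-trans x≤ (2^-mono (≤-trans (m≤m+n a b) (n≤1+n _))))
op-bound mul {x} {y} {a} {b} x≤ y≤ = begin
  x * y           ≤⟨ *-mono-≤ x≤ y≤ ⟩
  2 ^ a * 2 ^ b   ≡⟨ ^-distribˡ-+-* 2 a b ⟨
  2 ^ (a + b)     ≤⟨ 2^-mono (n≤1+n (a + b)) ⟩
  2 ^ suc (a + b) ∎
  where open ≤-Reasoning
op-bound div {y = zero}  x≤ y≤ = z≤n
op-bound div {x} {suc y} {a} {b} x≤ y≤ =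
  ≤-trans (m/n≤m x (suc y)) (≤-trans x≤ (2^-mono (≤-trans (m≤m+n a b) (n≤1+n _))))

big-bound : ∀ o c n f {b} → (∀ i → i < n → f i ≤ 2 ^ b) → big o c n f ≤ 2 ^ (c + n * suc b)
big-bound o c zero    f f≤ = ≤-trans (m≤2^m c) (2^-mono (m≤m+n c 0))
big-bound o c (suc n) f {b} f≤ = begin
  ⟦ o ⟧ (big o c n f) (f n)   ≤⟨ op-bound o {a = c + n * suc b} {b} (big-bound o c n f {b} (λ i i<n → f≤ i (m≤n⇒m≤1+n i<n))) (f≤ n ≤-refl) ⟩
  2 ^ suc (c + n * suc b + b) ≡⟨ cong (2 ^_) (begin-equality
    suc (c + n * suc b + b)   ≡⟨ +-suc (c + n * suc b) b ⟨
    c + n * suc b + suc b     ≡⟨ +-assoc c (n * suc b) (suc b) ⟩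
    c + (n * suc b + suc b)   ≡⟨ cong (c +_) (+-comm (n * suc b) (suc b)) ⟩
    c + suc n * suc b         ∎) ⟩
  2 ^ (c + suc n * suc b)     ∎
  where open ≤-Reasoning

read-bound : ∀ {b M} → All (_≤ b) M → ∀ a → read M a ≤ b
read-bound []       a       = z≤n
read-bound (p ∷ ps) zero    = p
read-bound (p ∷ ps) (suc a) = read-bound ps a

write-end : ∀ M v → write M (length M) v ≡ M ++ v ∷ []
write-end []      v = refl
write-end (w ∷ M) v = cong (w ∷_) (write-end M v)

bits-bound : ∀ {v w} → v ≤ 2 ^ w → bits v ≤ suc w
bits-bound {v} {w} v≤ = s≤s (≤-trans (⌊log₂⌋-mono-≤ v≤) (≤-reflexive (⌊log₂[2^n]⌋≡n w)))

-- Lets registers be named by plain numbers. Distinct numbers are distinct registers only up to `k`,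
-- hence the side conditions `≤ k` below.
clampFin : ∀ k → ℕ → Fin (suc k)
clampFin k       zero    = zero
clampFin zero    (suc r) = zero
clampFin (suc k) (suc r) = suc (clampFin k r)

toℕ-clampFin : ∀ k r → r ≤ k → toℕ (clampFin k r) ≡ r
toℕ-clampFin k       zero    _         = refl
toℕ-clampFin (suc k) (suc r) (s≤s r≤k) = cong suc (toℕ-clampFin k r r≤k)

-- Registers: 0 output, 1 order, 2 the constant one, 3 length of the memory,
-- 4 loop counter of appendLoop, from 5 on temporaries.

module Compile (k : ℕ) where

  # : ℕ → Fin (suc k)
  # = clampFin k

  -- `γ` names the registers of the variables; the result goes to register `d`, and registers below
  -- `d` are left alone. A copy is zeroing followed by addition. A fold uses `d` as accumulator,
  -- `suc d` as index and `2 + d` as the number of remaining rounds.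
  compile : ∀ {m} → Exp m → Vec ℕ m → ℕ → Cmd (suc k)
  compile (var x)      γ d = instr (const (# d) 0) ⨾ instr (op (# d) add (# (lookup γ x)) (# d))
  compile (lit c)      γ d = instr (const (# d) c)
  compile order        γ d = instr (const (# d) 0) ⨾ instr (op (# d) add (# 1) (# d))
  compile (bin o a b)  γ d =
    compile a γ d ⨾ compile b γ (suc d) ⨾ instr (op (# d) o (# d) (# (suc d)))
  compile (cell a)     γ d = compile a γ d ⨾ instr (load (# d) (# d))
  compile (fold o c a) γ d =
    instr (const (# d) c) ⨾
    instr (const (# (suc d)) 0) ⨾
    instr (const (# (2 + d)) 0) ⨾
    instr (op (# (2 + d)) add (# 1) (# (2 + d))) ⨾
    whilenz (# (2 + d))
      (compile a (suc d ∷ γ) (3 + d) ⨾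
       instr (op (# d) o (# d) (# (3 + d))) ⨾
       instr (op (# (suc d)) add (# (suc d)) (# 2)) ⨾
       instr (op (# (2 + d)) monus (# (2 + d)) (# 2)))

  assign : ∀ {m} → ℕ → Vec ℕ m → Exp m → Cmd (suc k)
  assign x γ e =
    compile e γ 5 ⨾ instr (const (# x) 0) ⨾ instr (op (# x) add (# x) (# 5))

  appendLoop : Exp 0 → Exp 1 → Cmd (suc k)
  appendLoop S E =
    assign 4 [] S ⨾
    whilenz (# 4)
      (compile E (3 ∷ []) 5 ⨾
       instr (store (# 3) (# 5)) ⨾
       instr (op (# 3) add (# 3) (# 2)) ⨾
       instr (op (# 4) monus (# 4) (# 2)))

  program : Exp 0 → Exp 1 → Exp 0 → Exp 1 → Cmd (suc k)
  program S₁ E₁ S₂ E₂ =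
    instr (const (# 2) 1) ⨾
    -- Register 0 still holds 0, so this fetches cell 0, the number of vertices.
    instr (load (# 1) (# 0)) ⨾
    assign {0} 3 [] inputLength ⨾
    appendLoop S₁ E₁ ⨾
    appendLoop S₂ E₂ ⨾
    assign 0 (3 ∷ []) lastCell

  -- Cost of single instructions and of loops

  module Cost (q W L : ℕ) (q≤W : q ≤ W) where

    -- An instruction is charged for at most two numbers, each at most `2 ^ W`.
    unit : ℕ
    unit = suc W + suc W

    cap : ℕ
    cap = suc k * suc W + L * suc W

    -- The invariant behind both resource bounds. Cells have their own exponent `q`, since what is
    -- loaded must be bounded independently of the expression being evaluated.
    record Fits (s : State (suc k)) : Set where
      constructor fits
      field
        regs≤ : ∀ x → reg s x ≤ 2 ^ W
        mem≤  : All (_≤ 2 ^ q) (mem s)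
        len≤  : length (mem s) ≤ L

    open Fits

    size≤ : ∀ {s} → Fits s → size s ≤ cap
    size≤ {s} F = +-mono-≤ (regsSize (regs s) (regs≤ F)) (≤-trans (memSize (mem≤ F)) (*-monoˡ-≤ (suc W) (len≤ F)))
      where
      regsSize : ∀ {j} (v : Vec ℕ j) → (∀ x → lookup v x ≤ 2 ^ W) →
                 Vec.sum (Vec.map bits v) ≤ j * suc W
      regsSize []      p = z≤n
      regsSize (x ∷ v) p = +-mono-≤ (bits-bound (p zero)) (regsSize v (p ∘ suc))
      memSize : ∀ {M} → All (_≤ 2 ^ q) M → sum (map bits M) ≤ length M * suc W
      memSize []       = z≤n
      memSize (p ∷ ps) = +-mono-≤ (bits-bound (≤-trans p (2^-mono q≤W))) (memSize ps)

    fits-setReg : ∀ {s} → Fits s → ∀ x {v} → v ≤ 2 ^ W → Fits (setReg s x v)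
    fits-setReg {s} F x {v} v≤ = fits regs≤′ (mem≤ F) (len≤ F)
      where
      regs≤′ : ∀ y → reg (setReg s x v) y ≤ 2 ^ W
      regs≤′ y with y ≟ᶠ x
      ... | yes refl = ≤-trans (≤-reflexive (lookup∘update x (regs s) v)) v≤
      ... | no  y≢x  = ≤-trans (≤-reflexive (lookup∘update′ y≢x (regs s) v)) (regs≤ F y)

    -- A total correctness triple. Time is counted in units and adds up under sequencing; the space
    -- bound is the same for all commands.
    record Exec (c : Cmd (suc k)) (s : State (suc k)) (t : ℕ) (Post : State (suc k) → Set) : Set where
      constructor execution
      field
        final  : State (suc k)
        run    : Run c s final
        time≤  : time run ≤ t * unit
        space≤ : space run ≤ cap
        post   : Post final

    infixr 4 _then_

    _then_ : ∀ {c d s t u P Q} → Exec c s t P → (∀ {s′} → P s′ → Exec d s′ u Q) →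
             Exec (c ⨾ d) s (t + u) Q
    _then_ {t = t} {u} (execution s₁ r₁ t₁ p₁ post₁) f with f post₁
    ... | execution s₂ r₂ t₂ p₂ post₂ =
      execution s₂ (r₁ ⨾ r₂)
        (≤-trans (+-mono-≤ t₁ t₂) (≤-reflexive (sym (*-distribʳ-+ unit t u))))
        (⊔-lub p₁ p₂) post₂

    bits≤unit : ∀ {v} → v ≤ 2 ^ W → bits v ≤ unit
    bits≤unit v≤ = ≤-trans (bits-bound v≤) (m≤m+n (suc W) (suc W))

    bits+bits≤unit : ∀ {v w} → v ≤ 2 ^ W → w ≤ 2 ^ W → bits v + bits w ≤ unit
    bits+bits≤unit v≤ w≤ = +-mono-≤ (bits-bound v≤) (bits-bound w≤)

    map-post : ∀ {c s t P Q} → (∀ {s′} → P s′ → Q s′) → Exec c s t P → Exec c s t Q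
    map-post f (execution s r t p post) = execution s r t p (f post)

    R : State (suc k) → ℕ → ℕ
    R s r = reg s (# r)

    R-same : ∀ s r v → R (setReg s (# r) v) r ≡ v
    R-same s r v = lookup∘update (# r) (regs s) v

    R-other : ∀ s {r r′} v → r ≤ k → r′ ≤ k → r ≢ r′ → R (setReg s (# r′) v) r ≡ R s r
    R-other s {r} {r′} v r≤ r′≤ r≢r′ = lookup∘update′ (λ eq → r≢r′ (begin-equality
        r         ≡⟨ toℕ-clampFin k r r≤ ⟨
        toℕ (# r) ≡⟨ cong toℕ eq ⟩
        toℕ (# r′) ≡⟨ toℕ-clampFin k r′ r′≤ ⟩
        r′        ∎)) (regs s) v
      where open ≤-Reasoning

    record Sets (x v : ℕ) (s t : State (suc k)) : Set where
      field
        sets-fits : Fits t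
        same      : R t x ≡ v
        memory    : mem t ≡ mem s
        below     : ∀ {r} → r < x → R t r ≡ R s r
        above     : ∀ {r} → x < r → r ≤ k → R t r ≡ R s r

    open Sets

    setReg-sets : ∀ {s x v} → x ≤ k → Fits (setReg s (# x) v) → Sets x v s (setReg s (# x) v)
    setReg-sets {s} {x} {v} x≤k F = record
      { sets-fits = F
      ; same      = R-same s x v
      ; memory    = refl
      ; below     = λ r<x → R-other s v (≤-trans (<⇒≤ r<x) x≤k) x≤k (<⇒≢ r<x)
      ; above     = λ x<r r≤k → R-other s v r≤k x≤k (>⇒≢ x<r)
      }

    one-step : ∀ i {s P} → cost i s ≤ unit → Fits s → Fits (exec i s) → P (exec i s) →
               Exec (instr i) s 1 P
    one-step i c≤ F F′ p =
      execution _ instr (≤-trans c≤ (≤-reflexive (sym (*-identityˡ unit)))) (⊔-lub (size≤ F) (size≤ F′)) p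

    const-step : ∀ x {c s} → x ≤ k → Fits s → c ≤ 2 ^ W →
                 Exec (instr (const (# x) c)) s 1 (Sets x c s)
    const-step x x≤k F c≤ = one-step _ (bits≤unit c≤) F F′ (setReg-sets x≤k F′)
      where F′ = fits-setReg F (# x) c≤

    op-step : ∀ x {o y z s v} → x ≤ k → Fits s → ⟦ o ⟧ (R s y) (R s z) ≡ v → v ≤ 2 ^ W →
              Exec (instr (op (# x) o (# y) (# z))) s 1 (Sets x v s)
    op-step x {y = y} {z} x≤k F refl v≤ =
      one-step _ (bits+bits≤unit (regs≤ F (# y)) (regs≤ F (# z))) F F′ (setReg-sets x≤k F′)
      where F′ = fits-setReg F (# x) v≤

    load-step : ∀ x {y s a} → x ≤ k → Fits s → R s y ≡ a →
                Exec (instr (load (# x) (# y))) s 1 (Sets x (read (mem s) a) s)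
    load-step x {y} {s} x≤k F refl =
      one-step _ (bits+bits≤unit (regs≤ F (# y)) r≤) F F′ (setReg-sets x≤k F′)
      where
      r≤ = ≤-trans (read-bound (mem≤ F) (R s y)) (2^-mono q≤W)
      F′ = fits-setReg F (# x) r≤

    record Appends (v : ℕ) (s t : State (suc k)) : Set where
      field
        appends-fits : Fits t
        appended     : mem t ≡ mem s ++ v ∷ []
        all-same     : ∀ r → R t r ≡ R s r

    open Appends

    -- The address is the current length, so `write` adds exactly one cell and no padding.
    append-step : ∀ {x y s v} → Fits s → R s x ≡ length (mem s) → R s y ≡ v →
                  length (mem s) < L → v ≤ 2 ^ q →
                  Exec (instr (store (# x) (# y))) s 1 (Appends v s)
    append-step {x} {y} {s} {v} F x≡ refl len< v≤ =
      one-step _ (bits+bits≤unit (regs≤ F (# x)) (regs≤ F (# y))) F F′ (record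
        { appends-fits = F′ ; appended = eq ; all-same = λ _ → refl })
      where
      eq : write (mem s) (R s x) v ≡ mem s ++ v ∷ []
      eq = trans (cong (λ a → write (mem s) a v) x≡) (write-end (mem s) v)
      F′ = fits (regs≤ F)
        (subst (All (_≤ 2 ^ q)) (sym eq) (++⁺ (mem≤ F) (v≤ ∷ [])))
        (≤-trans (≤-reflexive (trans (cong length eq) (length-snoc (mem s) v))) len<)

    -- The invariant is indexed by the value of the loop register, which drops by one per round.
    -- This fixes the number of rounds in advance; `suc t` includes the test before a round, and the
    -- final `1` is the failing test.
    loop : ∀ {x c t} (I : ℕ → State (suc k) → Set) →
           (∀ {i s} → I i s → reg s x ≡ i × Fits s) →
           (∀ {i s} → I (suc i) s → Exec c s t (I i)) →
           ∀ i {s} → I i s → Exec (whilenz x c) s (i * suc t + 1) (I 0)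
    loop I inv body zero {s} p with inv p
    ... | x≡0 , F = execution s (whileFalse x≡0)
                      (≤-trans (bits≤unit (regs≤ F _)) (≤-reflexive (sym (*-identityˡ unit)))) (size≤ F) p
    loop {x} {c} {t} I inv body (suc i) {s} p with inv p | body p
    ... | x≡ , F | execution s₁ r₁ t₁ p₁ post₁ with loop I inv body i post₁
    ... | execution s₂ r₂ t₂ p₂ post₂ =
      execution s₂ (whileTrue (λ x≡0 → 0≢1+n (trans (sym x≡0) x≡)) r₁ r₂) (begin
        bits (reg s x) + time r₁ + time r₂               ≤⟨ +-mono-≤ (+-mono-≤ (bits≤unit (regs≤ F x)) t₁) t₂ ⟩
        suc t * unit + (i * suc t + 1) * unit            ≡⟨ *-distribʳ-+ unit (suc t) (i * suc t + 1) ⟨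
        (suc t + (i * suc t + 1)) * unit                 ≡⟨ cong (_* unit) (+-assoc (suc t) (i * suc t) 1) ⟨
        (suc i * suc t + 1) * unit                       ∎) (⊔-lub p₁ p₂) post₂
      where open ≤-Reasoning

    -- Correctness and step counts of compiled expressions and of the program

    module Correct (n : ℕ) (n≤ : n ≤ 2 ^ q) where

      eval-bound : ∀ {m} (e : Exp m) {M ρ} → All (_≤ 2 ^ q) M → (∀ x → lookup ρ x ≤ 2 ^ q) →
                   eval e n M ρ ≤ 2 ^ width n q e
      eval-bound (var x)      M≤ ρ≤ = ρ≤ x
      eval-bound (lit c)      M≤ ρ≤ = m≤2^m c
      eval-bound order        M≤ ρ≤ = n≤
      eval-bound (bin o a b)  M≤ ρ≤ =
        op-bound o {a = width n q a} {width n q b} (eval-bound a M≤ ρ≤) (eval-bound b M≤ ρ≤)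
      eval-bound (cell a)     M≤ ρ≤ = ≤-trans (read-bound M≤ _) (2^-mono (m≤m+n q (width n q a)))
      eval-bound (fold o c a) M≤ ρ≤ =
        ≤-trans (big-bound o c n _ {width n q a} λ i i<n →
                  eval-bound a M≤ λ { zero → ≤-trans (<⇒≤ i<n) n≤ ; (suc x) → ρ≤ x })
                (2^-mono (+-monoʳ-≤ c (m≤n+m (n * suc (width n q a)) (suc (width n q a)))))

      record Ready {m} (γ : Vec ℕ m) (d : ℕ) (ρ : Vec ℕ m) (s : State (suc k)) : Set where
        field
          ready-fits : Fits s
          ord≡       : R s 1 ≡ n
          one≡       : R s 2 ≡ 1
          env≡       : ∀ x → R s (lookup γ x) ≡ lookup ρ x
          env≤       : ∀ x → lookup ρ x ≤ 2 ^ q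
          scope      : ∀ x → lookup γ x < d
          2<d        : 2 < d

      open Ready

      record Done (d v : ℕ) (s s′ : State (suc k)) : Set where
        constructor done
        field
          done-fits : Fits s′
          value     : R s′ d ≡ v
          mem≡      : mem s′ ≡ mem s
          kept      : ∀ {r} → r < d → R s′ r ≡ R s r

      open Done

      ready-kept : ∀ {m} {γ : Vec ℕ m} {d d′ ρ s s′} → Ready γ d ρ s → d ≤ d′ → Fits s′ →
                   (∀ {r} → r < d → R s′ r ≡ R s r) → Ready γ d′ ρ s′
      ready-kept H d≤d′ F kept = record
        { ready-fits = F
        ; ord≡ = trans (kept (<-trans (n<1+n 1) (2<d H))) (ord≡ H)
        ; one≡ = trans (kept (2<d H)) (one≡ H)
        ; env≡ = λ x → trans (kept (scope H x)) (env≡ H x)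
        ; env≤ = env≤ H
        ; scope = λ x → ≤-trans (scope H x) d≤d′
        ; 2<d = ≤-trans (2<d H) d≤d′
        }

      copy : ∀ {d r s v} → Fits s → r < d → d ≤ k → R s r ≡ v →
             Exec (instr (const (# d) 0) ⨾ instr (op (# d) add (# r) (# d))) s 2 (Done d v s)
      copy {d} {r} {s} {v} F r<d d≤k r≡ =
        const-step d d≤k F z≤n then λ S₁ →
        map-post
          (λ S₂ → done (sets-fits S₂) (same S₂) (trans (memory S₂) (memory S₁))
                    (λ r<d → trans (below S₂ r<d) (below S₁ r<d)))
          (op-step d d≤k (sets-fits S₁)
            (trans (cong₂ _+_ (trans (below S₁ r<d) r≡) (same S₁)) (+-identityʳ v))
            (subst (_≤ 2 ^ W) r≡ (regs≤ F (# r))))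

      -- Induction on `e`. Preservation of the registers below the target keeps the first operand in
      -- `d` while the second is computed from `suc d` upwards, and the loop data of a fold while
      -- its body runs.
      compile-exec : ∀ {m} (e : Exp m) {γ d ρ s} → Ready γ d ρ s → d + temps e ≤ k →
                     width n q e ≤ W →
                     Exec (compile e γ d) s (steps n e) (Done d (eval e n (mem s) ρ) s)
      compile-exec (var x) {d = d} H d≤ w≤ =
        copy (ready-fits H) (scope H x) (≤-trans (m≤m+n d 0) d≤) (env≡ H x)
      compile-exec order {d = d} H d≤ w≤ =
        copy (ready-fits H) (<-trans (n<1+n 1) (2<d H)) (≤-trans (m≤m+n d 0) d≤) (ord≡ H)
      compile-exec (lit c) {d = d} H d≤ w≤ =
        map-post
          (λ S → done (sets-fits S) (same S) (memory S) (below S))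
          (const-step d (≤-trans (m≤m+n d 0) d≤) (ready-fits H) (≤-trans (m≤2^m c) (2^-mono w≤)))
      compile-exec (cell a) {d = d} {ρ} {s} H d≤ w≤ =
        compile-exec a H d≤ (≤-trans (m≤n+m _ q) w≤) then λ D →
        map-post
          (λ S → done (sets-fits S)
                   (trans (same S) (cong (λ M → read M (eval a n (mem s) ρ)) (mem≡ D)))
                   (trans (memory S) (mem≡ D))
                   (λ r<d → trans (below S r<d) (kept D r<d)))
          (load-step d (≤-trans (m≤m+n d _) d≤) (done-fits D) (value D))
      compile-exec (bin o a b) {d = d} {ρ} {s} H d≤ w≤ =
        compile-exec a H (≤-trans (+-monoʳ-≤ d (≤-trans (m≤m+n _ _) (n≤1+n _))) d≤)
          (≤-trans (≤-trans (m≤m+n _ _) (n≤1+n _)) w≤) then λ D₁ →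
        compile-exec b (ready-kept H (n≤1+n d) (done-fits D₁) (kept D₁))
          (≤-trans (≤-trans (≤-reflexive (sym (+-suc d (temps b)))) (+-monoʳ-≤ d (s≤s (m≤n+m _ (temps a))))) d≤)
          (≤-trans (≤-trans (m≤n+m _ _) (n≤1+n _)) w≤) then λ D₂ →
        map-post
          (λ S → done (sets-fits S) (same S) (trans (memory S) (trans (mem≡ D₂) (mem≡ D₁)))
                   (λ r<d → trans (below S r<d) (trans (kept D₂ (m≤n⇒m≤1+n r<d)) (kept D₁ r<d))))
          (op-step d (≤-trans (m≤m+n d _) d≤) (done-fits D₂)
            (cong₂ ⟦ o ⟧ (trans (kept D₂ (n<1+n d)) (value D₁))
                         (trans (value D₂) (cong (λ M → eval b n M ρ) (mem≡ D₁))))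
            (≤-trans (eval-bound (bin o a b) (mem≤ (ready-fits H)) (env≤ H)) (2^-mono w≤)))
      compile-exec (fold o c a) {γ} {d} {ρ} {s} H d≤ w≤ =
        const-step d d≤k (ready-fits H) (≤-trans (m≤2^m c) (2^-mono (≤-trans (m≤m+n c _) w≤))) then λ S₁ →
        const-step (suc d) 1+d≤k (sets-fits S₁) z≤n then λ S₂ →
        const-step (2 + d) 2+d≤k (sets-fits S₂) z≤n then λ S₃ →
        op-step (2 + d) 2+d≤k (sets-fits S₃)
          (trans (cong₂ _+_
                   (trans (below S₃ (up (up 1<d))) (trans (below S₂ (up 1<d)) (trans (below S₁ 1<d) (ord≡ H))))
                   (same S₃))
                 (+-identityʳ n))
          (≤-trans n≤ (2^-mono q≤W)) then λ S₄ →
        map-post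
          (λ { (j , j+0≡n , J) → done (inv-fits J)
                 (trans (acc≡ J) (cong (λ j → big o c j f) (trans (sym (+-identityʳ j)) j+0≡n)))
                 (inv-mem J) (inv-kept J) })
          (loop Inv (λ { (j , _ , J) → cnt≡ J , inv-fits J }) body n
            (0 , refl , record
              { inv-fits = sets-fits S₄
              ; acc≡ = trans (below S₄ (up ≤-refl)) (trans (below S₃ (up ≤-refl))
                         (trans (below S₂ ≤-refl) (same S₁)))
              ; idx≡ = trans (below S₄ ≤-refl) (trans (below S₃ ≤-refl) (same S₂))
              ; cnt≡ = same S₄
              ; inv-mem = trans (memory S₄) (trans (memory S₃) (trans (memory S₂) (memory S₁)))
              ; inv-kept = λ r<d → trans (below S₄ (up (up r<d))) (trans (below S₃ (up (up r<d)))
                             (trans (below S₂ (up r<d)) (below S₁ r<d)))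
              }))
        where
        up : ∀ {i j} → i ≤ j → i ≤ suc j
        up = m≤n⇒m≤1+n
        f : ℕ → ℕ
        f i = eval a n (mem s) (i ∷ ρ)
        3+d+temps≤k : 3 + d + temps a ≤ k
        3+d+temps≤k = ≤-trans (≤-reflexive (trans (cong (_+ temps a) (+-comm 3 d)) (+-assoc d 3 (temps a)))) d≤
        2+d≤k : 2 + d ≤ k
        2+d≤k = ≤-trans (≤-trans (n≤1+n _) (m≤m+n (3 + d) (temps a))) 3+d+temps≤k
        1+d≤k : 1 + d ≤ k
        1+d≤k = ≤-trans (n≤1+n _) 2+d≤k
        d≤k : d ≤ k
        d≤k = ≤-trans (n≤1+n _) 1+d≤k
        1<d : 1 < d
        1<d = <-trans (n<1+n 1) (2<d H)
        width≤W : width n q a ≤ W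
        width≤W = ≤-trans (≤-trans (n≤1+n _) (m≤m+n (suc (width n q a)) (n * suc (width n q a)))) (≤-trans (m≤n+m _ c) w≤)
        f≤ : ∀ i → i < n → f i ≤ 2 ^ width n q a
        f≤ i i<n = eval-bound a (mem≤ (ready-fits H)) λ { zero → ≤-trans (<⇒≤ i<n) n≤ ; (suc x) → env≤ H x }
        -- `j` rounds are done and `i` remain: the body needs an index counting up, the loop test a
        -- register counting down.
        record Invariant (j i : ℕ) (t : State (suc k)) : Set where
          field
            inv-fits : Fits t
            acc≡     : R t d ≡ big o c j f
            idx≡     : R t (suc d) ≡ j
            cnt≡     : R t (2 + d) ≡ i
            inv-mem  : mem t ≡ mem s
            inv-kept : ∀ {r} → r < d → R t r ≡ R s r
        open Invariant
        Inv : ℕ → State (suc k) → Set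
        Inv i t = ∃[ j ] j + i ≡ n × Invariant j i t
        body : ∀ {i t} → Inv (suc i) t →
               Exec (compile a (suc d ∷ γ) (3 + d) ⨾
                     instr (op (# d) o (# d) (# (3 + d))) ⨾
                     instr (op (# (suc d)) add (# (suc d)) (# 2)) ⨾
                     instr (op (# (2 + d)) monus (# (2 + d)) (# 2))) t (steps n a + 3) (Inv i)
        body {i} {t} (j , j+i≡n , J) =
          compile-exec a
            (record
              { ready-fits = inv-fits J
              ; ord≡ = trans (inv-kept J 1<d) (ord≡ H)
              ; one≡ = trans (inv-kept J (2<d H)) (one≡ H)
              ; env≡ = λ { zero → idx≡ J ; (suc x) → trans (inv-kept J (scope H x)) (env≡ H x) }
              ; env≤ = λ { zero → ≤-trans (<⇒≤ j<n) n≤ ; (suc x) → env≤ H x }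
              ; scope = λ { zero → up ≤-refl ; (suc x) → up (up (up (scope H x))) }
              ; 2<d = up (up (up (2<d H)))
              }) 3+d+temps≤k width≤W then λ D →
          op-step d d≤k (done-fits D)
            (cong₂ ⟦ o ⟧ (trans (kept D (up (up ≤-refl))) (acc≡ J))
                         (trans (value D) (cong (λ M → eval a n M (j ∷ ρ)) (inv-mem J))))
            (≤-trans (big-bound o c (suc j) f {width n q a} λ i i<j → f≤ i (≤-trans i<j j<n))
              (2^-mono (≤-trans (+-monoʳ-≤ c (*-monoˡ-≤ (suc (width n q a)) (up j<n))) w≤))) then λ S₁ →
          op-step (suc d) 1+d≤k (sets-fits S₁)
            (trans (cong₂ _+_ (trans (above S₁ ≤-refl 1+d≤k) (trans (kept D (up ≤-refl)) (idx≡ J)))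
                              (trans (below S₁ (2<d H)) (trans (kept D (up (up (up (2<d H))))) (trans (inv-kept J (2<d H)) (one≡ H)))))
                   (+-comm j 1))
            (≤-trans j<n (≤-trans n≤ (2^-mono q≤W))) then λ S₂ →
          map-post
            (λ S₃ → suc j , trans (sym (+-suc j i)) j+i≡n , record
              { inv-fits = sets-fits S₃
              ; acc≡ = trans (below S₃ (up ≤-refl)) (trans (below S₂ ≤-refl) (same S₁))
              ; idx≡ = trans (below S₃ ≤-refl) (same S₂)
              ; cnt≡ = same S₃
              ; inv-mem = trans (memory S₃) (trans (memory S₂) (trans (memory S₁) (trans (mem≡ D) (inv-mem J))))
              ; inv-kept = λ r<d → trans (below S₃ (up (up r<d))) (trans (below S₂ (up r<d))
                             (trans (below S₁ r<d) (trans (kept D (up (up (up r<d)))) (inv-kept J r<d))))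
              })
            (op-step (2 + d) 2+d≤k (sets-fits S₂)
              (cong₂ _∸_ (trans (above S₂ ≤-refl 2+d≤k) (trans (above S₁ (up ≤-refl) 2+d≤k) (trans (kept D ≤-refl) (cnt≡ J))))
                (trans (below S₂ (up (2<d H))) (trans (below S₁ (2<d H)) (trans (kept D (up (up (up (2<d H))))) (trans (inv-kept J (2<d H)) (one≡ H))))))
              (≤-trans (≤-trans (n≤1+n i) (≤-trans (m≤n+m (suc i) j) (≤-reflexive j+i≡n))) (≤-trans n≤ (2^-mono q≤W))))
          where
          j<n : j < n
          j<n = ≤-trans (s≤s (m≤m+n j i)) (≤-reflexive (trans (sym (+-suc j i)) j+i≡n))

      Assigned : ℕ → ℕ → State (suc k) → State (suc k) → Set
      Assigned x v s t =
        Fits t × R t x ≡ v × mem t ≡ mem s × (∀ {r} → r < 5 → r ≢ x → R t r ≡ R s r)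

      assign-exec : ∀ {m} x (e : Exp m) {γ ρ s} → x < 5 → Ready γ 5 ρ s → 5 + temps e ≤ k →
                    width n q e ≤ W →
                    Exec (assign x γ e) s (steps n e + 2) (Assigned x (eval e n (mem s) ρ) s)
      assign-exec x e {ρ = ρ} {s} x<5 H 5≤ w≤ =
        compile-exec e H 5≤ w≤ then λ D →
        const-step x x≤k (done-fits D) z≤n then λ S₁ →
        map-post
          (λ S₂ → sets-fits S₂ , same S₂ , trans (memory S₂) (trans (memory S₁) (mem≡ D)) ,
                  λ r<5 r≢x → trans (elsewhere S₂ r<5 r≢x) (trans (elsewhere S₁ r<5 r≢x) (kept D r<5)))
          (op-step x x≤k (sets-fits S₁)
            (cong₂ _+_ (same S₁) (trans (above S₁ x<5 5≤k) (value D)))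
            (≤-trans (eval-bound e (mem≤ (ready-fits H)) (env≤ H)) (2^-mono w≤)))
        where
        5≤k : 5 ≤ k
        5≤k = ≤-trans (m≤m+n 5 _) 5≤
        x≤k : x ≤ k
        x≤k = ≤-trans (<⇒≤ x<5) 5≤k
        elsewhere : ∀ {r v s t} → Sets x v s t → r < 5 → r ≢ x → R t r ≡ R s r
        elsewhere {r} S r<5 r≢x with <-cmp r x
        ... | tri< r<x _ _ = below S r<x
        ... | tri≈ _ r≡x _ = contradiction r≡x r≢x
        ... | tri> _ _ x<r = above S x<r (≤-trans (<⇒≤ r<5) 5≤k)

      record Steady (s : State (suc k)) : Set where
        field
          steady-fits : Fits s
          steady-ord  : R s 1 ≡ n
          steady-one  : R s 2 ≡ 1
          ptr≡        : R s 3 ≡ length (mem s)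

      open Steady

      steady⇒ready : ∀ {s} → L ≤ 2 ^ q → Steady s → Ready (3 ∷ []) 5 (length (mem s) ∷ []) s
      steady⇒ready L≤ H = record
        { ready-fits = steady-fits H
        ; ord≡ = steady-ord H
        ; one≡ = steady-one H
        ; env≡ = λ { zero → ptr≡ H }
        ; env≤ = λ { zero → ≤-trans (len≤ (steady-fits H)) L≤ }
        ; scope = λ { zero → s≤s (s≤s (s≤s (s≤s z≤n))) }
        ; 2<d = s≤s (s≤s (s≤s z≤n))
        }

      -- The bound on `E` is assumed for every memory, so the cell bound is established afresh for
      -- each entry instead of growing with the entries it was computed from.
      appendLoop-exec : ∀ S E {s} i → Steady s → L ≤ 2 ^ q → eval S n (mem s) [] ≡ i →
                        (∀ M ρ → eval E n M ρ ≤ 2 ^ q) → length (mem s) + i ≤ L →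
                        5 + temps S ≤ k → width n q S ≤ W → 5 + temps E ≤ k → width n q E ≤ W →
                        Exec (appendLoop S E) s (steps n S + 2 + (i * suc (steps n E + 3) + 1))
                          (λ t → Steady t × mem t ≡ emit E n i (mem s))
      appendLoop-exec S E {s} i H L≤ refl E≤ len≤L S≤ wS≤ E≤k wE≤ =
        assign-exec 4 S ≤-refl
          (record { ready-fits = steady-fits H ; ord≡ = steady-ord H ; one≡ = steady-one H
                  ; env≡ = λ () ; env≤ = λ () ; scope = λ () ; 2<d = s≤s (s≤s (s≤s z≤n)) }) S≤ wS≤ then
        λ { (F , cnt≡ , mem≡ , kept) →
        map-post (λ J → steady J , emits J)
          (loop Inv (λ J → cnt J , steady-fits (steady J)) body i (record
            { steady = record
                { steady-fits = F
                ; steady-ord = trans (kept (s≤s (s≤s z≤n)) λ ()) (steady-ord H)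
                ; steady-one = trans (kept (s≤s (s≤s (s≤s z≤n))) λ ()) (steady-one H)
                ; ptr≡ = trans (kept (s≤s (s≤s (s≤s (s≤s z≤n)))) λ ()) (trans (ptr≡ H) (cong length (sym mem≡)))
                }
            ; cnt = cnt≡
            ; emits = cong (emit E n i) mem≡
            ; room = subst (λ M → length M + i ≤ L) (sym mem≡) len≤L
            })) }
        where
        -- `emits` compares the memories after all remaining rounds; `emit` is tail recursive, so
        -- one round is one unfolding of it.
        record Inv (j : ℕ) (t : State (suc k)) : Set where
          field
            steady : Steady t
            cnt    : R t 4 ≡ j
            emits  : emit E n j (mem t) ≡ emit E n i (mem s)
            room   : length (mem t) + j ≤ L
        open Inv
        5≤k : 5 ≤ k
        5≤k = ≤-trans (m≤m+n 5 _) S≤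
        4≤k : 4 ≤ k
        4≤k = ≤-trans (n≤1+n 4) 5≤k
        3≤k : 3 ≤ k
        3≤k = ≤-trans (n≤1+n 3) 4≤k
        body : ∀ {j t} → Inv (suc j) t →
               Exec (compile E (3 ∷ []) 5 ⨾
                     instr (store (# 3) (# 5)) ⨾
                     instr (op (# 3) add (# 3) (# 2)) ⨾
                     instr (op (# 4) monus (# 4) (# 2))) t (steps n E + 3) (Inv j)
        body {j} {t} J =
          compile-exec E (steady⇒ready L≤ (steady J)) E≤k wE≤ then λ D →
          append-step (done-fits D)
            (trans (kept D 3<5) (trans (ptr≡ (steady J)) (cong length (sym (mem≡ D)))))
            (value D) (subst (λ M → length M < L) (sym (mem≡ D)) len<L) (E≤ (mem t) _) then λ A →
          op-step 3 3≤k (appends-fits A)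
            (trans (cong₂ _+_ (trans (all-same A 3) (trans (kept D 3<5) (ptr≡ (steady J))))
                              (trans (all-same A 2) (trans (kept D 2<5) (steady-one (steady J)))))
                   (+-comm (length (mem t)) 1))
            (≤-trans (≤-trans len<L L≤) (2^-mono q≤W)) then λ S₁ →
          map-post
            (λ S₂ →
              let mem≡′ = trans (memory S₂) (trans (memory S₁) (trans (appended A)
                            (cong (_++ eval E n (mem t) (length (mem t) ∷ []) ∷ []) (mem≡ D)))) in
              record
              { steady = record
                  { steady-fits = sets-fits S₂
                  ; steady-ord = trans (below S₂ 1<4) (trans (below S₁ 1<3) (trans (all-same A 1) (trans (kept D 1<5) (steady-ord (steady J)))))
                  ; steady-one = trans (below S₂ 2<4) (trans (below S₁ 2<3) (trans (all-same A 2) (trans (kept D 2<5) (steady-one (steady J)))))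
                  ; ptr≡ = trans (below S₂ 3<4) (trans (same S₁) (sym (trans (cong length mem≡′) (length-snoc (mem t) _))))
                  }
              ; cnt = same S₂
              ; emits = trans (cong (emit E n j) mem≡′) (emits J)
              ; room = ≤-trans (≤-reflexive (trans (cong (λ M → length M + j) mem≡′)
                         (trans (cong (_+ j) (length-snoc (mem t) _)) (sym (+-suc (length (mem t)) j))))) (room J)
              })
            (op-step 4 4≤k (sets-fits S₁)
              (cong₂ _∸_ (trans (above S₁ 3<4 4≤k) (trans (all-same A 4) (trans (kept D ≤-refl) (cnt J))))
                (trans (below S₁ 2<3) (trans (all-same A 2) (trans (kept D 2<5) (steady-one (steady J))))))
              (≤-trans (≤-trans (≤-trans (n≤1+n j) (≤-trans (m≤n+m (suc j) (length (mem t))) (room J))) L≤) (2^-mono q≤W)))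
          where
          3<5 : 3 < 5
          3<5 = s≤s (s≤s (s≤s (s≤s z≤n)))
          2<5 : 2 < 5
          2<5 = s≤s (s≤s (s≤s z≤n))
          1<5 : 1 < 5
          1<5 = s≤s (s≤s z≤n)
          2<3 : 2 < 3
          2<3 = ≤-refl
          1<3 : 1 < 3
          1<3 = s≤s (s≤s z≤n)
          3<4 : 3 < 4
          3<4 = ≤-refl
          2<4 : 2 < 4
          2<4 = s≤s (s≤s (s≤s z≤n))
          1<4 : 1 < 4
          1<4 = s≤s (s≤s z≤n)
          len<L : length (mem t) < L
          len<L = ≤-trans (≤-trans (s≤s (m≤m+n _ j)) (≤-reflexive (sym (+-suc _ j)))) (room J)

      length-emit : ∀ E i M → length (emit E n i M) ≡ length M + i
      length-emit E zero    M = sym (+-identityʳ (length M))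
      length-emit E (suc i) M =
        trans (length-emit E i _) (trans (cong (_+ i) (length-snoc M _)) (sym (+-suc (length M) i)))

      program-exec :
        ∀ S₁ E₁ S₂ E₂ i₁ i₂ {M} → L ≡ length M + i₁ + i₂ → L ≤ 2 ^ q →
        length M ≡ suc (n * n) → read M 0 ≡ n → All (_≤ 2 ^ q) M →
        (∀ M → eval S₁ n M [] ≡ i₁) → (∀ M → eval S₂ n M [] ≡ i₂) →
        (∀ M ρ → eval E₁ n M ρ ≤ 2 ^ q) → (∀ M ρ → eval E₂ n M ρ ≤ 2 ^ q) →
        5 + temps (inputLength {0}) ≤ k → width n q (inputLength {0}) ≤ W →
        5 + temps S₁ ≤ k → width n q S₁ ≤ W → 5 + temps E₁ ≤ k → width n q E₁ ≤ W →
        5 + temps S₂ ≤ k → width n q S₂ ≤ W → 5 + temps E₂ ≤ k → width n q E₂ ≤ W →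
        5 + temps lastCell ≤ k → width n q lastCell ≤ W →
        let M₂ = emit E₂ n i₂ (emit E₁ n i₁ M) in
        Exec (program S₁ E₁ S₂ E₂) (initial M)
          (1 + (1 + (steps n (inputLength {0}) + 2 +
            (steps n S₁ + 2 + (i₁ * suc (steps n E₁ + 3) + 1) +
            (steps n S₂ + 2 + (i₂ * suc (steps n E₂ + 3) + 1) + (steps n lastCell + 2))))))
          (λ t → reg t zero ≡ read M₂ (length M₂ ∸ 1))
      program-exec S₁ E₁ S₂ E₂ i₁ i₂ {M} L≡ L≤ lenM M0≡n M≤ S₁≡ S₂≡ E₁≤ E₂≤ kI wI kS₁ wS₁ kE₁ wE₁ kS₂ wS₂ kE₂ wE₂ kO wO =
        const-step 2 2≤k F₀ (m^n>0 2 W) then λ A →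
        load-step 1 {y = 0} 1≤k (sets-fits A) (trans (below A (s≤s z≤n)) (lookup-replicate (# 0) 0)) then λ B →
        let ord = trans (same B) (trans (cong (λ M → read M 0) (memory A)) M0≡n)
            one = trans (above B ≤-refl 2≤k) (same A)
            mem = trans (memory B) (memory A) in
        assign-exec 3 inputLength {γ = []} {ρ = []} (s≤s (s≤s (s≤s (s≤s z≤n))))
          (record { ready-fits = sets-fits B ; ord≡ = ord ; one≡ = one
                  ; env≡ = λ () ; env≤ = λ () ; scope = λ () ; 2<d = s≤s (s≤s (s≤s z≤n)) }) kI wI then
        λ { (F , ptr , mem′ , kept) →
        appendLoop-exec S₁ E₁ i₁
          (record { steady-fits = F ; steady-ord = trans (kept (s≤s (s≤s z≤n)) λ ()) ord
                  ; steady-one = trans (kept (s≤s (s≤s (s≤s z≤n))) λ ()) one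
                  ; ptr≡ = trans ptr (trans (sym lenM) (cong length (sym (trans mem′ mem)))) })
          L≤ (S₁≡ _) E₁≤
          (subst (λ M → length M + i₁ ≤ L) (sym (trans mem′ mem)) (≤-trans (m≤m+n _ i₂) (≤-reflexive (sym L≡))))
          kS₁ wS₁ kE₁ wE₁ then
        λ { (H₁ , mem₁) →
        let mem₁′ = trans mem₁ (cong (emit E₁ n i₁) (trans mem′ mem)) in
        appendLoop-exec S₂ E₂ i₂ H₁ L≤ (S₂≡ _) E₂≤
          (≤-reflexive (trans (cong (_+ i₂) (trans (cong length mem₁′) (length-emit E₁ i₁ M))) (sym L≡)))
          kS₂ wS₂ kE₂ wE₂ then
        λ { (H₂ , mem₂) →
        let mem₂′ = trans mem₂ (cong (emit E₂ n i₂) mem₁′) in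
        map-post
          (λ { (_ , out , _) → trans out (cong (λ M → read M (length M ∸ 1)) mem₂′) })
          (assign-exec 0 lastCell (s≤s z≤n) (steady⇒ready L≤ H₂) kO wO) } } }
        where
        5≤k : 5 ≤ k
        5≤k = ≤-trans (m≤m+n 5 _) kI
        2≤k : 2 ≤ k
        2≤k = ≤-trans (s≤s (s≤s z≤n)) 5≤k
        1≤k : 1 ≤ k
        1≤k = ≤-trans (s≤s z≤n) 5≤k
        F₀ : Fits (initial M)
        F₀ = fits (λ x → ≤-trans (≤-reflexive (lookup-replicate x 0)) z≤n) M≤
               (≤-trans (≤-trans (m≤m+n _ i₁) (m≤m+n _ i₂)) (≤-reflexive (sym L≡)))

-- Logical formulas as arithmetic expressions

-- Any nonzero number counts as true, so that conjunction is a product and disjunction and existence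
-- are sums, without normalisation in between.
Represents : ℕ → Set → Set
Represents a P = a ≢ 0 ⇔ P

rep-dec : ∀ {a P} → Represents a P → Dec P
rep-dec {zero}  R = no λ p → from R p refl
rep-dec {suc a} R = yes (to R λ ())

-- `b` has to be right only under `P`: otherwise the product vanishes anyway. This is how a
-- membership test guards a lookup.
rep-× : ∀ {a b P Q} → Represents a P → (P → Represents b Q) → Represents (a * b) (P × Q)
rep-× {a} {b} {P} {Q} R S = mk⇔ to′ from′
  where
  to′ : a * b ≢ 0 → P × Q
  to′ ab≢0 = p , to (S p) λ { refl → ab≢0 (*-zeroʳ a) }
    where
    p : P
    p = to R λ { refl → ab≢0 refl }
  from′ : P × Q → a * b ≢ 0
  from′ (p , q) ab≡0 with m*n≡0⇒m≡0∨n≡0 a ab≡0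
  ... | inj₁ a≡0 = from R p a≡0
  ... | inj₂ b≡0 = from (S p) q b≡0

rep-⊎ : ∀ {a b P Q} → Represents a P → Represents b Q → Represents (a + b) (P ⊎ Q)
rep-⊎ {zero}  R S = mk⇔ (inj₂ ∘ to S) λ { (inj₁ p) _ → from R p refl ; (inj₂ q) → from S q }
rep-⊎ {suc a} R S = mk⇔ (λ _ → inj₁ (to R λ ())) λ _ ()

rep-¬ : ∀ {a P} → Represents a P → Represents (1 ∸ a) (¬ P)
rep-¬ {zero}  R = mk⇔ (λ _ p → from R p refl) λ _ ()
rep-¬ {suc a} R = mk⇔ (λ 0≢0 → contradiction (0∸n≡0 a) 0≢0) λ ¬p → contradiction (to R λ ()) ¬p

rep-< : ∀ a b → Represents (a ∸ b) (b < a)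
rep-< a b = mk⇔ (λ a∸b≢0 → ≰⇒> λ a≤b → a∸b≢0 (m≤n⇒m∸n≡0 a≤b)) m>n⇒m∸n≢0

sg : ℕ → ℕ
sg a = 1 ∸ (1 ∸ a)

sg≤1 : ∀ a → sg a ≤ 1
sg≤1 a = m∸n≤m 1 (1 ∸ a)

rep-sg : ∀ {a P} → Represents a P → Represents (sg a) P
rep-sg {zero}  R = R
rep-sg {suc a} R rewrite 0∸n≡0 a = mk⇔ (λ _ → to R λ ()) λ _ ()

eq : ℕ → ℕ → ℕ
eq i j = 1 ∸ ((i ∸ j) + (j ∸ i))

rep-≡ : ∀ i j → Represents (eq i j) (i ≡ j)
rep-≡ i j = mk⇔ to′ from′
  where
  R : Represents (eq i j) (¬ (j < i ⊎ i < j))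
  R = rep-¬ (rep-⊎ (rep-< i j) (rep-< j i))
  to′ : eq i j ≢ 0 → i ≡ j
  to′ e = ≤-antisym (≮⇒≥ (to R e ∘ inj₁)) (≮⇒≥ (to R e ∘ inj₂))
  from′ : i ≡ j → eq i j ≢ 0
  from′ refl = from R λ { (inj₁ i<i) → <-irrefl refl i<i ; (inj₂ i<i) → <-irrefl refl i<i }

-- Bounded sums as quantifiers and counters, and powers of two

∑ : ℕ → (ℕ → ℕ) → ℕ
∑ = big add 0

∑-cong : ∀ n {f g} → (∀ i → i < n → f i ≡ g i) → ∑ n f ≡ ∑ n g
∑-cong zero    f≡g = refl
∑-cong (suc n) f≡g = cong₂ _+_ (∑-cong n λ i i<n → f≡g i (m≤n⇒m≤1+n i<n)) (f≡g n ≤-refl)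

∑-suc : ∀ n f → ∑ (suc n) f ≡ f 0 + ∑ n (f ∘ suc)
∑-suc zero    f = +-comm 0 (f 0)
∑-suc (suc n) f = trans (cong (_+ f (suc n)) (∑-suc n f)) (+-assoc (f 0) _ _)

∑-* : ∀ n f c → ∑ n (λ i → f i * c) ≡ ∑ n f * c
∑-* zero    f c = refl
∑-* (suc n) f c = trans (cong (_+ f n * c) (∑-* n f c)) (sym (*-distribʳ-+ c (∑ n f) (f n)))

∑≤n : ∀ n f → (∀ i → f i ≤ 1) → ∑ n f ≤ n
∑≤n zero    f f≤ = z≤n
∑≤n (suc n) f f≤ = ≤-trans (+-mono-≤ (∑≤n n f f≤) (f≤ n)) (≤-reflexive (+-comm n 1))

rep-∑ : ∀ {n f} {P : Fin n → Set} → (∀ i → Represents (f (toℕ i)) (P i)) →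
        Represents (∑ n f) (∃[ i ] P i)
rep-∑ {n} {f} {P} R = mk⇔
  (λ ∑≢0 → let (i , i<n , fi≢0) = to (nonzero n f) ∑≢0 in
     fromℕ< i<n , to (R (fromℕ< i<n)) (subst (λ j → f j ≢ 0) (sym (toℕ-fromℕ< i<n)) fi≢0))
  (λ { (i , p) → from (nonzero n f) (toℕ i , toℕ<n i , from (R i) p) })
  where
  nonzero : ∀ n f → Represents (∑ n f) (∃[ i ] i < n × f i ≢ 0)
  nonzero zero    f = mk⇔ (λ 0≢0 → contradiction refl 0≢0) λ { (_ , () , _) }
  nonzero (suc n) f = mk⇔ to′ from′
    where
    R′ : Represents (∑ (suc n) f) ((∃[ i ] i < n × f i ≢ 0) ⊎ f n ≢ 0)
    R′ = rep-⊎ (nonzero n f) (mk⇔ id id)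
    to′ : ∑ (suc n) f ≢ 0 → ∃[ i ] i < suc n × f i ≢ 0
    to′ e with to R′ e
    ... | inj₁ (i , i<n , fi≢0) = i , m≤n⇒m≤1+n i<n , fi≢0
    ... | inj₂ fn≢0 = n , ≤-refl , fn≢0
    from′ : (∃[ i ] i < suc n × f i ≢ 0) → ∑ (suc n) f ≢ 0
    from′ (i , s≤s i≤n , fi≢0) with m≤n⇒m<n∨m≡n i≤n
    ... | inj₁ i<n  = from R′ (inj₁ (i , i<n , fi≢0))
    ... | inj₂ refl = from R′ (inj₂ fi≢0)

-- Recovers a number from its threshold tests. The induction is on `n` with `r` fixed and yields
-- `n ⊓ r`.
∑-count : ∀ n (h : ℕ → ℕ) r → r ≤ n → (∀ t → t < n → Represents (h t) (t < r)) → ∑ n (λ t → sg (h t)) ≡ r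
∑-count n h r r≤n R = trans (go n R) (m≥n⇒m⊓n≡n r≤n)
  where
  go : ∀ (n : ℕ) → (∀ t → t < n → Represents (h t) (t < r)) → ∑ n (λ t → sg (h t)) ≡ n ⊓ r
  go zero    R = refl
  go (suc n) R with h n | R n ≤-refl
  ... | zero  | Rn = trans (+-identityʳ _) (trans (go n λ t t<n → R t (m≤n⇒m≤1+n t<n))
                      (trans (m≥n⇒m⊓n≡n r≤n′) (sym (m≥n⇒m⊓n≡n (m≤n⇒m≤1+n r≤n′)))))
    where
    r≤n′ : r ≤ n
    r≤n′ = ≮⇒≥ λ n<r → from Rn n<r refl
  ... | suc a | Rn rewrite 0∸n≡0 a = trans (+-comm _ 1) (cong suc (trans (go n λ t t<n → R t (m≤n⇒m≤1+n t<n))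
                      (m≤n⇒m⊓n≡m (<⇒≤ n<r)))) ⨾⨾ sym (m≤n⇒m⊓n≡m n<r)
    where
    infixl 1 _⨾⨾_
    _⨾⨾_ = trans
    n<r : n < r
    n<r = to Rn λ ()

-- A fold always has `n` rounds, so the factor is 2 for `t < i` and 1 otherwise. The product is
-- `2 ^ i` only for `i ≤ n`.
pow : ℕ → ℕ → ℕ
pow n i = big mul 1 n (λ t → 1 + sg (i ∸ t))

pow≡ : ∀ n {i} → i ≤ n → pow n i ≡ 2 ^ i
pow≡ n {i} i≤n = trans (go n) (cong (2 ^_) (m≤n⇒m⊓n≡m i≤n))
  where
  go : ∀ (n : ℕ) → pow n i ≡ 2 ^ (i ⊓ n)
  go zero    = cong (2 ^_) (sym (⊓-zeroʳ i))
  go (suc n) with i ≤? n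
  ... | yes i≤n rewrite go n | m≤n⇒m∸n≡0 i≤n =
    trans (*-identityʳ _) (cong (2 ^_) (trans (m≤n⇒m⊓n≡m i≤n) (sym (m≤n⇒m⊓n≡m (m≤n⇒m≤1+n i≤n)))))
  ... | no  i≰n rewrite go n with i ∸ n | m>n⇒m∸n≢0 (≰⇒> i≰n)
  ...   | zero  | z≢0 = contradiction refl z≢0
  ...   | suc d | _ rewrite 0∸n≡0 d =
    trans (cong (λ e → 2 ^ e * 2) (m≥n⇒m⊓n≡n (<⇒≤ (≰⇒> i≰n))))
      (trans (*-comm (2 ^ n) 2) (cong (2 ^_) (sym (m≥n⇒m⊓n≡n (≰⇒> i≰n)))))

-- Vertex sets as bit masks

div≡/ : ∀ a b .{{_ : NonZero b}} → ⟦ div ⟧ a b ≡ a / b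
div≡/ a (suc b) = refl

-- The remainder modulo 2, expressed by the available operations.
low : ℕ → ℕ
low h = h ∸ ⟦ div ⟧ h 2 * 2

bit : ℕ → ℕ → ℕ → ℕ
bit n X i = low (⟦ div ⟧ X (pow n i))

digit : Side → ℕ
digit outside = 0
digit inside  = 1

digit<2 : ∀ b → digit b < 2
digit<2 outside = s≤s z≤n
digit<2 inside  = s≤s (s≤s z≤n)

idx : ∀ {n} → Subset n → ℕ
idx []      = 0
idx (b ∷ U) = digit b + idx U * 2

idx/2 : ∀ {n} b (U : Subset n) → idx (b ∷ U) / 2 ≡ idx U
idx/2 b U = trans (+-distrib-/ (digit b) (idx U * 2) lemma)
              (cong₂ _+_ (m<n⇒m/n≡0 (digit<2 b)) (m*n/n≡m (idx U) 2))
  where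
  lemma : digit b % 2 + idx U * 2 % 2 < 2
  lemma = subst (_< 2) (sym (trans (cong₂ _+_ (m<n⇒m%n≡m (digit<2 b)) (m*n%n≡0 (idx U) 2)) (+-identityʳ (digit b)))) (digit<2 b)

low≡%2 : ∀ h → low h ≡ h % 2
low≡%2 h = sym (m%n≡m∸m/n*n h 2)

rep-∈ : ∀ {n} (U : Subset n) (i : Fin n) → Represents (bit n (idx U) (toℕ i)) (i ∈ U)
rep-∈ {n} U i = subst (λ a → Represents a (i ∈ U)) (sym bit≡) (go U i)
  where
  bit≡ : bit n (idx U) (toℕ i) ≡ _/_ (idx U) (2 ^ toℕ i) {{m^n≢0 2 (toℕ i)}} % 2
  bit≡ = trans (low≡%2 (⟦ div ⟧ (idx U) (pow n (toℕ i)))) (cong (_% 2)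
    (trans (cong (⟦ div ⟧ (idx U)) (pow≡ n (<⇒≤ (toℕ<n i)))) (div≡/ (idx U) (2 ^ toℕ i) {{m^n≢0 2 (toℕ i)}})))
  go : ∀ {n} (U : Subset n) (i : Fin n) →
       Represents (_/_ (idx U) (2 ^ toℕ i) {{m^n≢0 2 (toℕ i)}} % 2) (i ∈ U)
  go (b ∷ U) zero = subst (λ a → Represents a (zero ∈ b ∷ U))
    (sym (trans (cong (_% 2) (n/1≡n (idx (b ∷ U)))) (trans ([m+kn]%n≡m%n (digit b) (idx U) 2) (m<n⇒m%n≡m (digit<2 b)))))
    (rep-digit b)
    where
    rep-digit : ∀ b → Represents (digit b) (zero ∈ b ∷ U)
    rep-digit outside = mk⇔ (λ 0≢0 → contradiction refl 0≢0) λ ()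
    rep-digit inside  = mk⇔ (λ _ → here) λ _ ()
  go (b ∷ U) (suc i) = subst (λ a → Represents a (suc i ∈ b ∷ U))
    (cong (_% 2) (trans (cong (λ X → _/_ X (2 ^ toℕ i) {{m^n≢0 2 (toℕ i)}}) (sym (idx/2 b U)))
      (m/n/o≡m/[n*o] (idx (b ∷ U)) 2 (2 ^ toℕ i) {{_}} {{m^n≢0 2 (toℕ i)}} {{m^n≢0 2 (suc (toℕ i))}})))
    (mk⇔ (there ∘ to (go U i)) (from (go U i) ∘ drop-there))

idx-remove : ∀ {n} {U : Subset n} {i} → i ∈ U → idx U ≡ idx (U - i) + 2 ^ toℕ i
idx-remove {U = inside ∷ U} {zero} here =
  trans (+-comm 1 (idx U * 2)) (cong (λ V → idx V * 2 + 1) (sym (p─⊥≡p U)))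
idx-remove {U = b ∷ U} {suc i} (there i∈U) = begin
  digit b + idx U * 2                              ≡⟨ cong (λ X → digit b + X * 2) (idx-remove i∈U) ⟩
  digit b + (idx (U - i) + 2 ^ toℕ i) * 2           ≡⟨ cong (digit b +_) (*-distribʳ-+ 2 (idx (U - i)) (2 ^ toℕ i)) ⟩
  digit b + (idx (U - i) * 2 + 2 ^ toℕ i * 2)       ≡⟨ +-assoc (digit b) _ _ ⟨
  digit b + idx (U - i) * 2 + 2 ^ toℕ i * 2         ≡⟨ cong₂ _+_ (cong (λ c → digit c + idx (U - i) * 2) (keep b)) (*-comm (2 ^ toℕ i) 2) ⟩
  idx ((b ∷ U) - suc i) + 2 ^ suc (toℕ i)           ∎
  where
  open ≡-Reasoning
  keep : ∀ b → b ≡ lookup ((b ∷ U) - suc i) zero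
  keep outside = refl
  keep inside  = refl

idx-⊆ : ∀ {n} {C U : Subset n} → C ⊆ U → idx C ≤ idx U
idx-⊆ {C = []}    {[]}    C⊆U = z≤n
idx-⊆ {C = b ∷ C} {c ∷ U} C⊆U = +-mono-≤ (head b c C⊆U) (*-monoˡ-≤ 2 (idx-⊆ (drop-∷-⊆ C⊆U)))
  where
  head : ∀ b c → b ∷ C ⊆ c ∷ U → digit b ≤ digit c
  head outside c       p = z≤n
  head inside  inside  p = ≤-refl
  head inside  outside p with p here
  ... | ()

idx-remove-< : ∀ {n} {U : Subset n} {i} → i ∈ U → idx (U - i) < idx U
idx-remove-< {U = U} {i} i∈U =
  ≤-trans (m<m+n (idx (U - i)) (m^n>0 2 (toℕ i))) (≤-reflexive (sym (idx-remove i∈U)))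

idx-∸ : ∀ {n} {U : Subset n} {i} → i ∈ U → idx U ∸ pow n (toℕ i) ≡ idx (U - i)
idx-∸ {n} {U} {i} i∈U =
  trans (cong₂ _∸_ (idx-remove i∈U) (pow≡ n (<⇒≤ (toℕ<n i)))) (m+n∸n≡m (idx (U - i)) (2 ^ toℕ i))

idx-⊂ : ∀ {n} {C U : Subset n} {i} → C ⊆ U → i ∈ U → i ∉ C → idx C < idx U
idx-⊂ {C = C} {U} {i} C⊆U i∈U i∉C =
  ≤-<-trans (idx-⊆ {C = C} {U - i} λ {v} v∈C → x∈p∧x≢y⇒x∈p-y (C⊆U v∈C) λ { refl → i∉C v∈C }) (idx-remove-< i∈U)

idx-⊤ : ∀ n → suc (idx {n} ⊤) ≡ 2 ^ n
idx-⊤ zero    = refl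
idx-⊤ (suc n) = trans (cong (_* 2) (idx-⊤ n)) (*-comm (2 ^ n) 2)

idx<2^n : ∀ {n} (U : Subset n) → idx U < 2 ^ n
idx<2^n {n} U = ≤-trans (s≤s (idx-⊆ {C = U} {⊤} ⊆⊤)) (≤-reflexive (idx-⊤ n))

-- Assembles the mask of a set, in the application a component, from membership tests; `sg` makes
-- each member contribute its power of two exactly once.
idx-∑ : ∀ {n} (C : Subset n) (g : ℕ → ℕ) → (∀ i → Represents (g (toℕ i)) (i ∈ C)) →
        ∑ n (λ v → pow n v * sg (g v)) ≡ idx C
idx-∑ {n} C g R = trans (∑-cong n λ i i<n → cong (_* sg (g i)) (pow≡ n (<⇒≤ i<n))) (go C g R)
  where
  go : ∀ {n} (C : Subset n) (g : ℕ → ℕ) → (∀ i → Represents (g (toℕ i)) (i ∈ C)) →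
       ∑ n (λ v → 2 ^ v * sg (g v)) ≡ idx C
  go []      g R = refl
  go {suc n} (b ∷ C) g R = begin
    ∑ (suc n) (λ v → 2 ^ v * sg (g v))                        ≡⟨ ∑-suc n _ ⟩
    1 * sg (g 0) + ∑ n (λ v → 2 ^ suc v * sg (g (suc v)))      ≡⟨ cong₂ _+_ (trans (*-identityˡ _) (first b (R zero))) (∑-cong n λ v _ → shift v) ⟩
    digit b + ∑ n (λ v → 2 ^ v * sg (g (suc v)) * 2)           ≡⟨ cong (digit b +_) (∑-* n _ 2) ⟩
    digit b + ∑ n (λ v → 2 ^ v * sg (g (suc v))) * 2           ≡⟨ cong (λ X → digit b + X * 2) (go C (g ∘ suc) λ i → mk⇔ (drop-there ∘ to (R (suc i))) (from (R (suc i)) ∘ there)) ⟩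
    digit b + idx C * 2                                        ∎
    where
    open ≡-Reasoning
    first : ∀ b → Represents (g 0) (zero ∈ b ∷ C) → sg (g 0) ≡ digit b
    first b R with g 0
    first outside R | zero  = refl
    first inside  R | zero  = contradiction refl (from R here)
    first outside R | suc a with to R (λ ())
    ... | ()
    first inside  R | suc a rewrite 0∸n≡0 a = refl
    shift : ∀ v → 2 ^ suc v * sg (g (suc v)) ≡ 2 ^ v * sg (g (suc v)) * 2
    shift v = trans (*-assoc 2 (2 ^ v) _) (*-comm 2 (2 ^ v * sg (g (suc v))))

-- Reading the encoded digraph

read-++ˡ : ∀ M {X a} → a < length M → read (M ++ X) a ≡ read M a
read-++ˡ (v ∷ M) {a = zero}  _         = refl
read-++ˡ (v ∷ M) {a = suc a} (s≤s a<) = read-++ˡ M a<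

read-++ʳ : ∀ M {X} a → read (M ++ X) (length M + a) ≡ read X a
read-++ʳ []      a = refl
read-++ʳ (v ∷ M) a = read-++ʳ M a

length-cPW : ∀ {A B C : Set} (f : A → B → C) xs ys →
             length (cartesianProductWith f xs ys) ≡ length xs * length ys
length-cPW f []       ys = refl
length-cPW f (x ∷ xs) ys = trans (length-++ (map (f x) ys)) (cong₂ _+_ (length-map (f x) ys) (length-cPW f xs ys))

length-encode : ∀ {n} (G : Digraph n) → length (encode G) ≡ suc (n * n)
length-encode {n} G = cong suc (trans (length-cPW _ (allFin n) (allFin n))
  (cong₂ _*_ (length-tabulate {n = n} id) (length-tabulate {n = n} id)))

encoded : Bool → ℕ
encoded b = if b then 1 else 0

position< : ∀ {n} u (i : Fin n) {u′} → u < u′ → u * n + toℕ i < u′ * n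
position< {n} u i {u′} u<u′ =
  ≤-trans (+-monoʳ-< (u * n) (toℕ<n i)) (≤-trans (≤-reflexive (+-comm (u * n) n)) (*-monoˡ-≤ n u<u′))

read-encode : ∀ {n} (G : Digraph n) X i j →
              read (encode G ++ X) (suc (toℕ i * n + toℕ j)) ≡ encoded (G i j)
read-encode {n} G X i j = trans
  (read-++ˡ (encode G) {X} (≤-trans (s≤s (position< (toℕ i) j (toℕ<n i))) (≤-reflexive (sym (length-encode G)))))
  (rows id i)
  where
  row : ∀ {m} (g : Fin n → ℕ) (a : Fin m → Fin n) j → read (map g (tabulate a)) (toℕ j) ≡ g (a j)
  row g a zero    = refl
  row g a (suc j) = row g (a ∘ suc) j
  rows : ∀ {m} (a : Fin m → Fin n) i →
         read (cartesianProductWith (λ u v → encoded (G u v)) (tabulate a) (allFin n)) (toℕ i * n + toℕ j)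
           ≡ encoded (G (a i) j)
  rows {suc m} a zero = trans
    (read-++ˡ (map (encoded ∘ G (a zero)) (allFin n)) (≤-trans (toℕ<n j) (≤-reflexive (sym length-row))))
    (row (encoded ∘ G (a zero)) id j)
    where
    length-row : length (map (encoded ∘ G (a zero)) (allFin n)) ≡ n
    length-row = trans (length-map _ (allFin n)) (length-tabulate {n = n} id)
  rows {suc m} a (suc i) = begin
    read (first ++ rest) (n + toℕ i * n + toℕ j)                ≡⟨ cong (read (first ++ rest)) (+-assoc n (toℕ i * n) (toℕ j)) ⟩
    read (first ++ rest) (n + (toℕ i * n + toℕ j))              ≡⟨ cong (λ l → read (first ++ rest) (l + (toℕ i * n + toℕ j))) length-row ⟨
    read (first ++ rest) (length first + (toℕ i * n + toℕ j))   ≡⟨ read-++ʳ first (toℕ i * n + toℕ j) ⟩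
    read rest (toℕ i * n + toℕ j)                               ≡⟨ rows (a ∘ suc) i ⟩
    encoded (G (a (suc i)) j)                                   ∎
    where
    open ≡-Reasoning
    first = map (encoded ∘ G (a zero)) (allFin n)
    rest  = cartesianProductWith (λ u v → encoded (G u v)) (tabulate (a ∘ suc)) (allFin n)
    length-row : length first ≡ n
    length-row = trans (length-map _ (allFin n)) (length-tabulate {n = n} id)

rep-edge : ∀ {n} (G : Digraph n) X i j →
           Represents (read (encode G ++ X) (suc (toℕ i * n + toℕ j))) (T (G i j))
rep-edge G X i j rewrite read-encode G X i j with G i j
... | true  = mk⇔ (λ _ → _) λ _ ()
... | false = mk⇔ (λ 0≢0 → contradiction refl 0≢0) λ ()

-- The recurrences for reachability and cycle rank

rep-⇔ : ∀ {a P Q} → Represents a P → P ⇔ Q → Represents a Q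
rep-⇔ R P⇔Q = mk⇔ (to P⇔Q ∘ to R) (from R ∘ from P⇔Q)

maximizer : ∀ {n} (f : Fin n → ℕ) {U u} → u ∈ U → ∃[ v ] v ∈ U × (∀ w → w ∈ U → f w ≤ f v)
maximizer {n} f {U} {u} u∈U =
  argmax f u xs , argmax-all f u∈U (all-filter (_∈? U) (allFin n)) ,
  λ w w∈U → All.lookup (f[xs]≤f[argmax] {f = f} u xs) (∈-filter⁺ (_∈? U) (∈-allFin w) w∈U)
  where xs = filter (_∈? U) (allFin n)

minimizer : ∀ {n} (f : Fin n → ℕ) {U u} → u ∈ U → ∃[ v ] v ∈ U × (∀ w → w ∈ U → f v ≤ f w)
minimizer {n} f {U} {u} u∈U =
  argmin f u xs , argmin-all f u∈U (all-filter (_∈? U) (allFin n)) ,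
  λ w w∈U → All.lookup (f[argmin]≤f[xs] {f = f} u xs) (∈-filter⁺ (_∈? U) (∈-allFin w) w∈U)
  where xs = filter (_∈? U) (allFin n)

comprehension : ∀ {n} {P : Fin n → Set} → (∀ v → Dec (P v)) → Subset n
comprehension P? = Vec.tabulate λ v → does (P? v)

∈-comprehension : ∀ {n} {P : Fin n → Set} (P? : ∀ v → Dec (P v)) v → v ∈ comprehension P? ⇔ P v
∈-comprehension {P = P} P? v = mk⇔
  (λ v∈ → to′ (trans (sym (lookup∘tabulate (does ∘ P?) v)) ([]=⇒lookup v∈)))
  (λ p → lookup⇒[]= v _ (trans (lookup∘tabulate (does ∘ P?) v) (dec-true (P? v) p)))
  where
  to′ : does (P? v) ≡ true → P v
  to′ e with P? v
  ... | yes p = p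

module _ {n} (G : Digraph n) where

  edge-mono : ∀ {C U u v} → C ⊆ U → Edge G C u v → Edge G U u v
  edge-mono C⊆U (u∈C , v∈C , e) = C⊆U u∈C , C⊆U v∈C , e

  target∈ : ∀ {U u v} → u ∈ U → Reachable G U u v → v ∈ U
  target∈ u∈U ε = u∈U
  target∈ u∈U ((_ , w∈U , _) ◅ p) = target∈ w∈U p

  -- Cut a walk from i at its last visit to i.

  last-exit : ∀ {U i j} x → i ≢ j → j ∈ U → Reachable G U x j →
              (x ∈ U - i × Reachable G (U - i) x j) ⊎
              (∃[ y ] T (G i y) × y ∈ U - i × Reachable G (U - i) y j)
  last-exit x i≢j j∈U ε = inj₁ (x∈p∧x≢y⇒x∈p-y j∈U (i≢j ∘ sym) , ε)
  last-exit {i = i} x i≢j j∈U (_◅_ {j = y} (x∈U , y∈U , e) p) with last-exit y i≢j j∈U p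
  ... | inj₂ exit = inj₂ exit
  ... | inj₁ (y∈ , p′) with x ≟ᶠ i
  ...   | yes refl = inj₂ (y , e , y∈ , p′)
  ...   | no  x≢i  = inj₁ (x∈ , (x∈ , y∈ , e) ◅ p′)
    where x∈ = x∈p∧x≢y⇒x∈p-y x∈U x≢i

  -- The empty walk makes every vertex reachable from itself, even outside `U`; hence the endpoints
  -- are required to lie in `U`.
  Connects : Subset n → Fin n → Fin n → Set
  Connects U i j = i ∈ U × j ∈ U × Reachable G U i j

  connects-step : ∀ {U i j} → i ∈ U → j ∈ U →
                  (toℕ i ≡ toℕ j ⊎ ∃[ k ] T (G i k) × Connects (U - i) k j) ⇔ Reachable G U i j
  connects-step {U} {i} {j} i∈U j∈U = mk⇔ to′ from′
    where
    to′ : (toℕ i ≡ toℕ j ⊎ ∃[ k ] T (G i k) × Connects (U - i) k j) → Reachable G U i j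
    to′ (inj₁ i≡j) rewrite toℕ-injective i≡j = ε
    to′ (inj₂ (k , e , k∈ , _ , p)) =
      (i∈U , p─q⊆p U ⁅ i ⁆ k∈ , e) ◅ Star.map (edge-mono (p─q⊆p U ⁅ i ⁆)) p
    from′ : Reachable G U i j → toℕ i ≡ toℕ j ⊎ ∃[ k ] T (G i k) × Connects (U - i) k j
    from′ ε = inj₁ refl
    from′ (_◅_ {j = y} (_ , _ , e) p) with i ≟ᶠ j
    ... | yes refl = inj₁ refl
    -- Either the walk behind the first edge avoids `i` and its start `y` is the wanted successor,
    -- or it returns to `i` and has its own last exit.
    ... | no  i≢j with last-exit y i≢j j∈U p
    ...   | inj₁ (y∈ , p′)        = inj₂ (y , e , y∈ , target∈ y∈ p′ , p′)
    ...   | inj₂ (k , e , k∈ , p′) = inj₂ (k , e , k∈ , target∈ k∈ p′ , p′)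

  -- Ensures that thresholds below `n` determine the rank, and that ranks fit into a cell.
  cycleRank≤ : ∀ {U r} → CycleRankOn G U r → r ≤ ∣ U ∣
  cycleRank≤ (acyclic _) = z≤n
  cycleRank≤ (strong _ _ f rank (_ , v , v∈U , refl)) = ≤-<-trans (cycleRank≤ (rank v v∈U)) (x∈p⇒∣p-x∣<∣p∣ v∈U)
  cycleRank≤ {U} (components _ f rank (_ , C , scc@(u , u∈U , C⇔) , refl)) =
    ≤-trans (cycleRank≤ (rank C scc)) (p⊆q⇒∣p∣≤∣q∣ λ v∈C → target∈ u∈U (proj₁ (to (C⇔ _) v∈C)))

-- The memory consists of the input, the reachability table with one n × n matrix
-- for each vertex set, and the rank table with one entry for each vertex set.

edgeAt : ℕ → Memory → ℕ → ℕ → ℕ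
edgeAt n M i j = read M (suc (i * n + j))

reachAt : ℕ → Memory → ℕ → ℕ → ℕ → ℕ
reachAt n M X i j = read M (suc (n * n) + ((X * n + i) * n + j))

rankAt : ℕ → Memory → ℕ → ℕ
rankAt n M X = read M (suc (n * n) + pow n n * n * n + X)

-- The guard `bit n X i` is essential: only for a member `i` is `X ∸ pow n i` the mask of the set
-- without `i`, whose matrix is already stored.
reachVal : ℕ → Memory → ℕ → ℕ → ℕ → ℕ
reachVal n M X i j =
  sg (bit n X i * (bit n X j * (eq i j + ∑ n (λ k → edgeAt n M i k * reachAt n M (X ∸ pow n i) k j))))

component : ℕ → Memory → ℕ → ℕ → ℕ
component n M X u = ∑ n (λ v → pow n v * sg (reachAt n M X u v * reachAt n M X v u))

separated : ℕ → Memory → ℕ → ℕ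
separated n M X = ∑ n (λ u → ∑ n (λ v → bit n X u * (bit n X v * (1 ∸ reachAt n M X u v))))

edges : ℕ → Memory → ℕ → ℕ
edges n M X = ∑ n (λ u → ∑ n (λ v → bit n X u * (bit n X v * edgeAt n M u v)))

-- The test `t < r`. A maximum exceeds `t` iff some component's rank does, where components are
-- listed by their vertices; and `t < 1 + min` iff no vertex deletion has rank below `t`. Without
-- either case the rank is 0 and no `t` passes.
exceeds : ℕ → Memory → ℕ → ℕ → ℕ
exceeds n M X t =
  separated n M X * ∑ n (λ u → bit n X u * (rankAt n M (component n M X u) ∸ t)) +
  (1 ∸ separated n M X) * (edges n M X * (1 ∸ ∑ n (λ v → bit n X v * (t ∸ rankAt n M (X ∸ pow n v)))))

-- A rank r ≤ n is computed as the number of t < n with t < r, so that neither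
-- maxima nor minima need to be formed.

rankVal : ℕ → Memory → ℕ → ℕ
rankVal n M X = ∑ n (λ t → sg (exceeds n M X t))

module _ {n} (G : Digraph n) (M : Memory)
         (rep-edgeAt : ∀ i j → Represents (edgeAt n M (toℕ i) (toℕ j)) (T (G i j))) where

  ReachStored : Subset n → Set
  ReachStored U = ∀ i j → Represents (reachAt n M (idx U) (toℕ i) (toℕ j)) (Connects G U i j)

  rep-reachVal : ∀ {U} → (∀ V → idx V < idx U → ReachStored V) →
                 ∀ i j → Represents (reachVal n M (idx U) (toℕ i) (toℕ j)) (Connects G U i j)
  rep-reachVal {U} stored i j =
    rep-sg (rep-× (rep-∈ U i) λ i∈U → rep-× (rep-∈ U j) λ j∈U →
      rep-⇔ (rep-⊎ (rep-≡ (toℕ i) (toℕ j))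
                   (rep-∑ λ k → rep-× (rep-edgeAt i k) λ _ →
                     subst (λ X → Represents (reachAt n M X (toℕ k) (toℕ j)) (Connects G (U - i) k j))
                       (sym (idx-∸ i∈U)) (stored (U - i) (idx-remove-< i∈U) k j)))
            (connects-step G i∈U j∈U))

  module _ {U} (stored : ReachStored U)
           (ranked : ∀ V → idx V < idx U → CycleRankOn G V (rankAt n M (idx V))) where

    private
      rank : Subset n → ℕ
      rank V = rankAt n M (idx V)

      Mutual : Fin n → Fin n → Set
      Mutual u v = Connects G U u v × Connects G U v u

      rep-mutual : ∀ u v → Represents (reachAt n M (idx U) (toℕ u) (toℕ v) * reachAt n M (idx U) (toℕ v) (toℕ u)) (Mutual u v)
      rep-mutual u v = rep-× (stored u v) λ _ → stored v u

      mutual? : ∀ u v → Dec (Mutual u v)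
      mutual? u v = rep-dec (rep-mutual u v)

      C : Fin n → Subset n
      C u = comprehension (mutual? u)

      component≡ : ∀ u → component n M (idx U) (toℕ u) ≡ idx (C u)
      component≡ u = idx-∑ (C u) (λ v → reachAt n M (idx U) (toℕ u) v * reachAt n M (idx U) v (toℕ u)) λ v →
        rep-⇔ (rep-mutual u v) (mk⇔ (from (∈-comprehension (mutual? u) v)) (to (∈-comprehension (mutual? u) v)))

      Separated : Set
      Separated = ∃[ u ] ∃[ v ] u ∈ U × v ∈ U × ¬ Connects G U u v

      rep-separated : Represents (separated n M (idx U)) Separated
      rep-separated = rep-∑ λ u → rep-∑ λ v →
        rep-× (rep-∈ U u) λ _ → rep-× (rep-∈ U v) λ _ → rep-¬ (stored u v)

      rep-edges : Represents (edges n M (idx U)) (HasEdge G U)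
      rep-edges = rep-∑ λ u → rep-∑ λ v →
        rep-× (rep-∈ U u) λ _ → rep-× (rep-∈ U v) λ _ → rep-edgeAt u v

      Exceeds : ℕ → Set
      Exceeds t = (Separated × ∃[ u ] u ∈ U × t < rank (C u)) ⊎
                  (¬ Separated × HasEdge G U × ¬ (∃[ v ] v ∈ U × rank (U - v) < t))

      rep-exceeds : ∀ t → Represents (exceeds n M (idx U) t) (Exceeds t)
      rep-exceeds t = rep-⊎
        (rep-× rep-separated λ _ → rep-∑ λ u → rep-× (rep-∈ U u) λ _ →
          subst (λ X → Represents (rankAt n M X ∸ t) (t < rank (C u))) (sym (component≡ u)) (rep-< (rank (C u)) t))
        (rep-× (rep-¬ rep-separated) λ _ → rep-× rep-edges λ _ → rep-¬ (rep-∑ λ v → rep-× (rep-∈ U v) λ v∈U →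
          subst (λ X → Represents (t ∸ rankAt n M X) (rank (U - v) < t)) (sym (idx-∸ v∈U)) (rep-< t (rank (U - v)))))

      rank-exceeds : ∀ r → CycleRankOn G U r → (∀ t → Exceeds t ⇔ t < r) →
                     CycleRankOn G U (rankVal n M (idx U))
      rank-exceeds r R e = subst (CycleRankOn G U)
        (sym (∑-count n _ r (≤-trans (cycleRank≤ G R) (∣p∣≤n U)) λ t _ → rep-⇔ (rep-exceeds t) (e t))) R

      C-connected : ∀ {u v} → v ∈ C u → Mutual u v
      C-connected {u} {v} = to (∈-comprehension (mutual? u) v)

      C⊆U : ∀ {u} → C u ⊆ U
      C⊆U v∈C = proj₁ (proj₂ (proj₁ (C-connected v∈C)))

      C-scc : ∀ {u} → u ∈ U → IsSCC G U (C u)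
      C-scc {u} u∈U = u , u∈U , λ v → mk⇔
        (λ v∈C → let ((_ , _ , p) , (_ , _ , q)) = C-connected v∈C in p , q)
        (λ { (p , q) → from (∈-comprehension (mutual? u) v)
               ((u∈U , target∈ G u∈U p , p) , (target∈ G u∈U p , u∈U , q)) })

      scc-C : ∀ {D} → IsSCC G U D → ∃[ u ] u ∈ U × D ≡ C u
      scc-C {D} (u , u∈U , D⇔) = u , u∈U , ⊆-antisym
        (λ {v} v∈D → from (proj₂ (proj₂ (C-scc u∈U)) v) (to (D⇔ v) v∈D))
        (λ {v} v∈C → from (D⇔ v) (to (proj₂ (proj₂ (C-scc u∈U)) v) v∈C))

      -- A component containing both vertices of a separated pair would connect them through `u`; so
      -- it misses one of them and is a proper subset.
      idx-C : Separated → ∀ u → idx (C u) < idx U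
      idx-C (a , b , a∈U , b∈U , ¬ab) u with a ∈? C u | b ∈? C u
      ... | no  a∉C | _       = idx-⊂ C⊆U a∈U a∉C
      ... | yes _   | no  b∉C = idx-⊂ C⊆U b∈U b∉C
      ... | yes a∈C | yes b∈C =
        contradiction (a∈U , b∈U , proj₂ (proj₂ (proj₂ (C-connected a∈C))) ◅◅ proj₂ (proj₂ (proj₁ (C-connected b∈C)))) ¬ab

      strongly : ¬ Separated → StronglyConnected G U
      strongly ¬sep {u} {v} u∈U v∈U with rep-dec (stored u v)
      ... | yes (_ , _ , p) = p
      ... | no  ¬p          = contradiction (u , v , u∈U , v∈U , ¬p) ¬sep

      -- Acyclicity is never tested as such. An acyclic set of several vertices falls under the
      -- first case, and its trivial components, like the empty set, under the last.
      by-cases : Dec Separated → Dec (HasEdge G U) → CycleRankOn G U (rankVal n M (idx U))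
      by-cases (yes sep@(a , b , a∈U , b∈U , ¬ab)) _ = rank-exceeds (rank (C u))
          (components (λ sc → ¬ab (a∈U , b∈U , sc a∈U b∈U)) rank
            (λ D scc → let (v , _ , D≡C) = scc-C scc in
               subst (λ D → CycleRankOn G D (rank D)) (sym D≡C) (ranked (C v) (idx-C sep v)))
            ((λ D scc → let (v , v∈U , D≡C) = scc-C scc in
               subst (λ D → rank D ≤ rank (C u)) (sym D≡C) (max v v∈U)) ,
             C u , C-scc u∈U , refl))
          λ t → mk⇔
            (λ { (inj₁ (_ , v , v∈U , t<)) → ≤-trans t< (max v v∈U)
               ; (inj₂ (¬sep , _)) → contradiction sep ¬sep })
            (λ t< → inj₁ (sep , u , u∈U , t<))
        where
        maximal = maximizer (rank ∘ C) a∈U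
        u = proj₁ maximal
        u∈U = proj₁ (proj₂ maximal)
        max = proj₂ (proj₂ maximal)
      by-cases (no ¬sep) (yes edge@(_ , _ , a∈U , _)) = rank-exceeds (suc (rank (U - u)))
          (strong (strongly ¬sep) edge (λ v → rank (U - v))
            (λ v v∈U → ranked (U - v) (idx-remove-< v∈U))
            (min , u , u∈U , refl))
          λ t → mk⇔
            (λ { (inj₁ (sep , _)) → contradiction sep ¬sep
               ; (inj₂ (_ , _ , ¬<t)) → s≤s (≮⇒≥ λ <t → ¬<t (u , u∈U , <t)) })
            (λ { (s≤s t≤) → inj₂ (¬sep , edge , λ { (v , v∈U , <t) → <⇒≱ <t (≤-trans t≤ (min v v∈U)) }) })
        where
        minimal = minimizer (λ v → rank (U - v)) a∈U
        u = proj₁ minimal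
        u∈U = proj₁ (proj₂ minimal)
        min = proj₂ (proj₂ minimal)
      by-cases (no ¬sep) (no ¬edge) = rank-exceeds 0
          (acyclic λ { D (u , u∈U , D⇔) (v , w , e) →
            ¬edge (v , w , edge-mono G (λ {x} x∈D → target∈ G u∈U (proj₁ (to (D⇔ x) x∈D))) e) })
          λ t → mk⇔
            (λ { (inj₁ (sep , _)) → contradiction sep ¬sep ; (inj₂ (_ , edge , _)) → contradiction edge ¬edge })
            λ ()

    rank-step : CycleRankOn G U (rankVal n M (idx U))
    rank-step = by-cases (rep-dec rep-separated) (rep-dec rep-edges)

-- The recurrences as expressions

-- Arguments named i⁺ live under the additional variable bound by powE.

sgE : ∀ {m} → Exp m → Exp m
sgE a = bin monus (lit 1) (bin monus (lit 1) a)

∑E : ∀ {m} → Exp (suc m) → Exp m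
∑E = fold add 0

powE : ∀ {m} → Exp (suc m) → Exp m
powE i⁺ = fold mul 1 (bin add (lit 1) (sgE (bin monus i⁺ (var zero))))

bitE : ∀ {m} → Exp m → Exp (suc m) → Exp m
bitE X i⁺ = bin monus h (bin mul (bin div h (lit 2)) (lit 2))
  where h = bin div X (powE i⁺)

eqE : ∀ {m} → Exp m → Exp m → Exp m
eqE i j = bin monus (lit 1) (bin add (bin monus i j) (bin monus j i))

edgeE : ∀ {m} → Exp m → Exp m → Exp m
edgeE i j = cell (bin add (lit 1) (bin add (bin mul i order) j))

reachE : ∀ {m} → Exp m → Exp m → Exp m → Exp m
reachE X i j = cell (bin add inputLength (bin add (bin mul (bin add (bin mul X order) i) order) j))

reachCount rankCount rankBase : ∀ {m} → Exp m
reachCount = bin mul (bin mul rankCount order) order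
rankCount  = powE order
rankBase   = bin add inputLength reachCount

rankE : ∀ {m} → Exp m → Exp m
rankE X = cell (bin add rankBase X)

pattern v0 = var zero
pattern v1 = var (suc zero)
pattern v2 = var (suc (suc zero))

-- The local functions split the offset `(X * n + i) * n + j` of the address into its parts. Their
-- argument is the de Bruijn index of the address, which grows with each enclosing fold.
reachValE : Exp 1
reachValE =
  sgE (bin mul (bitE (X zero) (i (suc zero))) (bin mul (bitE (X zero) (j (suc zero)))
    (bin add (eqE (i zero) (j zero))
      (∑E (bin mul (edgeE (i (suc zero)) v0)
                   (reachE (bin monus (X (suc zero)) (powE (i (suc (suc zero))))) v0 (j (suc zero))))))))
  where
  offset row X i j : ∀ {m} → Fin m → Exp m
  offset p = bin monus (var p) inputLength
  row p    = bin div (offset p) order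
  X p      = bin div (row p) order
  i p      = bin monus (row p) (bin mul (X p) order)
  j p      = bin monus (offset p) (bin mul (row p) order)

rankValE : Exp 1
rankValE =
  ∑E (sgE (bin add
    (bin mul separatedE (∑E (bin mul (bitE (X p2) v1) (bin monus (rankE componentE) v1))))
    (bin mul (bin monus (lit 1) separatedE)
      (bin mul edgesE
        (bin monus (lit 1) (∑E (bin mul (bitE (X p2) v1) (bin monus v1 (rankE (bin monus (X p2) (powE v1)))))))))))
  where
  p2 : Fin 3
  p2 = suc (suc zero)
  p3 : Fin 4
  p3 = suc (suc (suc zero))
  X : ∀ {m} → Fin m → Exp m
  X p = bin monus (var p) rankBase
  separatedE edgesE : Exp 2
  separatedE = ∑E (∑E (bin mul (bitE (X p3) v2) (bin mul (bitE (X p3) v1) (bin monus (lit 1) (reachE (X p3) v1 v0)))))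
  edgesE = ∑E (∑E (bin mul (bitE (X p3) v2) (bin mul (bitE (X p3) v1) (edgeE v1 v0))))
  componentE : Exp 3
  componentE = ∑E (bin mul (powE v1) (sgE (bin mul (reachE (X p3) v1 v0) (reachE (X p3) v0 v1))))

-- The expression mirrors the arithmetic definition operation by operation, so evaluation alone
-- proves this.
eval-reachValE : ∀ n M p →
  let x = p ∸ suc (n * n) ; r = ⟦ div ⟧ x n ; X = ⟦ div ⟧ r n in
  eval reachValE n M (p ∷ []) ≡ reachVal n M X (r ∸ X * n) (x ∸ r * n)
eval-reachValE n M p = refl

eval-rankValE : ∀ n M p →
  eval rankValE n M (p ∷ []) ≡ rankVal n M (p ∸ (suc (n * n) + pow n n * n * n))
eval-rankValE n M p = refl

-- Decoding of addresses and correctness of the filled tables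

div-position : ∀ {n} a (i : Fin n) → ⟦ div ⟧ (a * n + toℕ i) n ≡ a
div-position {suc n} a i = trans (cong (_/ suc n) (+-comm (a * suc n) (toℕ i)))
  (trans (+-distrib-/ (toℕ i) (a * suc n) (subst (_< suc n)
      (sym (trans (cong₂ _+_ (m<n⇒m%n≡m (toℕ<n i)) (m*n%n≡0 a (suc n))) (+-identityʳ (toℕ i)))) (toℕ<n i)))
    (cong₂ _+_ (m<n⇒m/n≡0 (toℕ<n i)) (m*n/n≡m a (suc n))))

mod-position : ∀ a n i → (a * n + i) ∸ a * n ≡ i
mod-position a n i = m+n∸m≡n (a * n) i

decode : ∀ {n} (F : ℕ → ℕ → ℕ → ℕ) a (i j : Fin n) {x} → x ≡ (a * n + toℕ i) * n + toℕ j →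
         let r = ⟦ div ⟧ x n ; X = ⟦ div ⟧ r n in
         F X (r ∸ X * n) (x ∸ r * n) ≡ F a (toℕ i) (toℕ j)
decode {n} F a i j refl = trans
  (go (div-position (a * n + toℕ i) j) (trans (cong (λ r → ⟦ div ⟧ r n) (div-position (a * n + toℕ i) j)) (div-position a i)))
  (cong₂ (F a) (mod-position a n (toℕ i)) (mod-position (a * n + toℕ i) n (toℕ j)))
  where
  go : ∀ {x r r′ X X′} → r ≡ r′ → X ≡ X′ → F X (r ∸ X * n) (x ∸ r * n) ≡ F X′ (r′ ∸ X′ * n) (x ∸ r′ * n)
  go refl refl = refl

-- Course-of-values induction along a table `X` behind the fixed part `M₀`: a new entry may rely on
-- all earlier entries.
emit-all : ∀ E n (P : ℕ → ℕ → Set) M₀ →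
           (∀ X → (∀ y → y < length X → P y (read X y)) →
             P (length X) (eval E n (M₀ ++ X) (length (M₀ ++ X) ∷ []))) →
           ∀ S → ∃[ X ] emit E n S M₀ ≡ M₀ ++ X × length X ≡ S × (∀ y → y < S → P y (read X y))
emit-all E n P M₀ step S = go S [] (sym (++-identityʳ M₀)) λ y ()
  where
  go : ∀ S X {M} → M ≡ M₀ ++ X → (∀ y → y < length X → P y (read X y)) →
       ∃[ Y ] emit E n S M ≡ M₀ ++ Y × length Y ≡ length X + S × (∀ y → y < length X + S → P y (read Y y))
  go zero    X refl H rewrite +-identityʳ (length X) = X , refl , refl , H
  go (suc S) X refl H with go S (X ++ v ∷ []) (++-assoc M₀ X (v ∷ [])) H′
    where
    v = eval E n (M₀ ++ X) (length (M₀ ++ X) ∷ [])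
    H′ : ∀ y → y < length (X ++ v ∷ []) → P y (read (X ++ v ∷ []) y)
    H′ y y< with m≤n⇒m<n∨m≡n (s≤s⁻¹ (subst (y <_) (length-snoc X v) y<))
    ... | inj₁ y<X = subst (P y) (sym (read-++ˡ X y<X)) (H y y<X)
    ... | inj₂ refl = subst (P (length X))
            (sym (trans (cong (read (X ++ v ∷ [])) (sym (+-identityʳ (length X)))) (read-++ʳ X 0))) (step X H)
  ... | Y , e , l , K rewrite length-snoc X (eval E n (M₀ ++ X) (length (M₀ ++ X) ∷ [])) | +-suc (length X) S = Y , e , l , K

module _ {n} (G : Digraph n) where

  position : Subset n → Fin n → Fin n → ℕ
  position U i j = (idx U * n + toℕ i) * n + toℕ j

  -- Quantifying over all indices with position `y` fits the form of `emit-all` and avoids inverting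
  -- `position` and `idx`.
  ReachAt RankAt : ℕ → ℕ → Set
  ReachAt y v = ∀ U i j → position U i j ≡ y → Represents v (Connects G U i j)
  RankAt  y v = ∀ U → idx U ≡ y → CycleRankOn G U v

  read-behind : ∀ M {X l} a → length M ≡ l → read (M ++ X) (l + a) ≡ read X a
  read-behind M a refl = read-++ʳ M a

  reachValE-correct : ∀ X → (∀ y → y < length X → ReachAt y (read X y)) →
               ReachAt (length X) (eval reachValE n (encode G ++ X) (length (encode G ++ X) ∷ []))
  reachValE-correct X H U i j pos≡ = subst (λ a → Represents a (Connects G U i j)) (sym value)
    (rep-reachVal G (encode G ++ X) (rep-edge G X) (λ V V<U i′ j′ →
      subst (λ a → Represents a (Connects G V i′ j′)) (sym (read-behind (encode G) (position V i′ j′) (length-encode G)))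
        (H (position V i′ j′) (≤-trans (earlier V V<U i′ j′) (≤-reflexive pos≡)) V i′ j′ refl)) i j)
    where
    -- The matrix of a smaller mask lies entirely in front, whatever the row and column.
    earlier : ∀ V → idx V < idx U → ∀ i′ j′ → position V i′ j′ < position U i j
    earlier V V<U i′ j′ = ≤-trans (position< _ j′ (≤-trans (position< _ i′ V<U) (m≤m+n _ (toℕ i)))) (m≤m+n _ (toℕ j))
    offset≡ : length (encode G ++ X) ∸ suc (n * n) ≡ position U i j
    offset≡ = trans (cong (_∸ suc (n * n)) (trans (length-++ (encode G)) (cong₂ _+_ (length-encode G) (sym pos≡))))
                (m+n∸m≡n (suc (n * n)) (position U i j))
    value : eval reachValE n (encode G ++ X) (length (encode G ++ X) ∷ [])
          ≡ reachVal n (encode G ++ X) (idx U) (toℕ i) (toℕ j)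
    value = trans (eval-reachValE n (encode G ++ X) (length (encode G ++ X)))
              (decode (reachVal n (encode G ++ X)) (idx U) i j offset≡)

  rankValE-correct : ∀ X → length X ≡ 2 ^ n * n * n → (∀ y → y < 2 ^ n * n * n → ReachAt y (read X y)) →
               ∀ Y → (∀ y → y < length Y → RankAt y (read Y y)) →
               RankAt (length Y) (eval rankValE n ((encode G ++ X) ++ Y) (length ((encode G ++ X) ++ Y) ∷ []))
  rankValE-correct X lenX reach Y H U idx≡ = subst (CycleRankOn G U) (sym value)
    (rank-step G M
      (λ i j → subst (λ M → Represents (edgeAt n M (toℕ i) (toℕ j)) (T (G i j))) (sym (++-assoc (encode G) X Y)) (rep-edge G (X ++ Y) i j))
      (λ i j → subst (λ a → Represents a (Connects G U i j)) (sym (stored i j)) (reach _ (position<size i j) U i j refl))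
      (λ V V<U → subst (CycleRankOn G V) (sym (read-behind (encode G ++ X) (idx V) base≡))
        (H (idx V) (≤-trans V<U (≤-reflexive idx≡)) V refl)))
    where
    M = (encode G ++ X) ++ Y
    pow≡′ : pow n n * n * n ≡ 2 ^ n * n * n
    pow≡′ = cong (λ N → N * n * n) (pow≡ n ≤-refl)
    base≡ : length (encode G ++ X) ≡ suc (n * n) + pow n n * n * n
    base≡ = trans (length-++ (encode G)) (cong₂ _+_ (length-encode G) (trans lenX (sym pow≡′)))
    position<size : ∀ i j → position U i j < 2 ^ n * n * n
    position<size i j = position< (idx U * n + toℕ i) j (position< (idx U) i (idx<2^n U))
    stored : ∀ i j → reachAt n M (idx U) (toℕ i) (toℕ j) ≡ read X (position U i j)
    stored i j = trans (cong (λ M → read M (suc (n * n) + position U i j)) (++-assoc (encode G) X Y))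
      (trans (read-behind (encode G) (position U i j) (length-encode G))
             (read-++ˡ X (≤-trans (position<size i j) (≤-reflexive (sym lenX)))))
    value : eval rankValE n M (length M ∷ []) ≡ rankVal n M (idx U)
    value = trans (eval-rankValE n M (length M)) (cong (rankVal n M)
      (trans (cong (_∸ (suc (n * n) + pow n n * n * n)) (trans (length-++ (encode G ++ X)) (cong₂ _+_ base≡ (sym idx≡))))
        (m+n∸m≡n (suc (n * n) + pow n n * n * n) (idx U))))

  tables : Memory
  tables = emit rankValE n (2 ^ n) (emit reachValE n (2 ^ n * n * n) (encode G))

  tables-correct : CycleRank G (read tables (length tables ∸ 1))
  tables-correct =
    let (X , e , lenX , reach) = emit-all reachValE n ReachAt (encode G) reachValE-correct (2 ^ n * n * n)
        (Y , e′ , lenY , rank) = emit-all rankValE n RankAt (encode G ++ X) (rankValE-correct X lenX reach) (2 ^ n) in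
    subst (CycleRankOn G ⊤)
      (sym (trans (cong (λ M → read M (length M ∸ 1)) (trans (cong (emit rankValE n (2 ^ n)) e) e′))
                  (read-last (encode G ++ X) Y (trans lenY (sym (idx-⊤ n))))))
      (rank (idx {n} ⊤) (idx<2^n {n} ⊤) ⊤ refl)
    where
    read-last : ∀ B Y {l} → length Y ≡ suc l → read (B ++ Y) (length (B ++ Y) ∸ 1) ≡ read Y l
    read-last B Y {l} lenY = begin
      read (B ++ Y) (length (B ++ Y) ∸ 1)     ≡⟨ cong (λ k → read (B ++ Y) (k ∸ 1)) (trans (length-++ B) (cong (length B +_) lenY)) ⟩
      read (B ++ Y) (length B + suc l ∸ 1)    ≡⟨ cong (λ k → read (B ++ Y) (k ∸ 1)) (+-suc (length B) l) ⟩
      read (B ++ Y) (length B + l)            ≡⟨ read-++ʳ B l ⟩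
      read Y l                                ∎
      where open ≡-Reasoning

-- Resource bounds

infix 4 _≼_

-- Powers of `suc n` instead of `n` are at least 1 and monotone in the degree for every `n`, so
-- bounds can be added and multiplied without a threshold.
record _≼_ (f g : ℕ → ℕ) : Set where
  constructor bounded
  field
    factor degree : ℕ
    bound         : ∀ n → f n ≤ factor * (g n * suc n ^ degree)

Polynomial : (ℕ → ℕ) → Set
Polynomial f = f ≼ λ _ → 1

≼-+ : ∀ {f f′ g} → f ≼ g → f′ ≼ g → (λ n → f n + f′ n) ≼ g
≼-+ {f} {f′} {g} (bounded c h f≤) (bounded c′ h′ f′≤) = bounded (c + c′) (h + h′) λ n → begin
  f n + f′ n                                             ≤⟨ +-mono-≤ (f≤ n) (f′≤ n) ⟩
  c * (g n * suc n ^ h) + c′ * (g n * suc n ^ h′)         ≤⟨ +-mono-≤ (*-monoʳ-≤ c (*-monoʳ-≤ (g n) (^-monoʳ-≤ (suc n) (m≤m+n h h′))))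
                                                                      (*-monoʳ-≤ c′ (*-monoʳ-≤ (g n) (^-monoʳ-≤ (suc n) (m≤n+m h′ h)))) ⟩
  c * (g n * suc n ^ (h + h′)) + c′ * (g n * suc n ^ (h + h′)) ≡⟨ *-distribʳ-+ (g n * suc n ^ (h + h′)) c c′ ⟨
  (c + c′) * (g n * suc n ^ (h + h′))                     ∎
  where open ≤-Reasoning

≼-* : ∀ {f f′ g} → f ≼ g → Polynomial f′ → (λ n → f n * f′ n) ≼ g
≼-* {f} {f′} {g} (bounded c h f≤) (bounded c′ h′ f′≤) = bounded (c * c′) (h + h′) λ n → begin
  f n * f′ n                                             ≤⟨ *-mono-≤ (f≤ n) (f′≤ n) ⟩
  c * (g n * suc n ^ h) * (c′ * (1 * suc n ^ h′))         ≡⟨ solve 5 (λ c a b d e → c :* (a :* b) :* (d :* (con 1 :* e)) := c :* d :* (a :* (b :* e))) refl c (g n) (suc n ^ h) c′ (suc n ^ h′) ⟩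
  c * c′ * (g n * (suc n ^ h * suc n ^ h′))               ≡⟨ cong (λ e → c * c′ * (g n * e)) (^-distribˡ-+-* (suc n) h h′) ⟨
  c * c′ * (g n * suc n ^ (h + h′))                       ∎
  where
  open ≤-Reasoning
  open +-*-Solver

≼-refl : ∀ {g} → g ≼ g
≼-refl {g} = bounded 1 0 λ n → ≤-reflexive (sym (trans (*-identityˡ _) (*-identityʳ (g n))))

poly-const : ∀ c → Polynomial (λ _ → c)
poly-const c = bounded c 0 λ n → ≤-reflexive (sym (*-identityʳ c))

poly-n : Polynomial (λ n → n)
poly-n = bounded 1 1 λ n → ≤-trans (n≤1+n n) (≤-reflexive (sym (trans (*-identityˡ _) (trans (*-identityˡ _) (*-identityʳ (suc n))))))

poly-suc : ∀ {f} → Polynomial f → Polynomial (λ n → suc (f n))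
poly-suc = ≼-+ (poly-const 1)

poly⇒≼ : ∀ {f g} → (∀ n → 1 ≤ g n) → Polynomial f → f ≼ g
poly⇒≼ 1≤g (bounded c h f≤) = bounded c h λ n → ≤-trans (f≤ n) (*-monoʳ-≤ c (*-monoˡ-≤ (suc n ^ h) (1≤g n)))

-- The expression does not depend on `n`: each fold contributes a factor `suc n`, and their nesting
-- depth is constant.
poly-width : ∀ {m} (e : Exp m) {q} → Polynomial q → Polynomial (λ n → width n (q n) e)
poly-width (var x)      Q = Q
poly-width (lit c)      Q = poly-const c
poly-width order        Q = Q
poly-width (bin o a b)  Q = poly-suc (≼-+ (poly-width a Q) (poly-width b Q))
poly-width (cell a)     Q = ≼-+ Q (poly-width a Q)
poly-width (fold o c a) Q = ≼-+ (poly-const c) (≼-* (poly-suc poly-n) (poly-suc (poly-width a Q)))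

poly-steps : ∀ {m} (e : Exp m) → Polynomial (λ n → steps n e)
poly-steps (var x)      = poly-const 2
poly-steps (lit c)      = poly-const 1
poly-steps order        = poly-const 2
poly-steps (bin o a b)  = ≼-+ (poly-steps a) (≼-+ (poly-steps b) (poly-const 1))
poly-steps (cell a)     = ≼-+ (poly-steps a) (poly-const 1)
poly-steps (fold o c a) = poly-suc (poly-suc (poly-suc (poly-suc
  (≼-+ (≼-* poly-n (poly-suc (≼-+ (poly-steps a) (poly-const 3)))) (poly-const 1)))))

*-^ : ∀ a b h → (a * b) ^ h ≡ a ^ h * b ^ h
*-^ a b zero    = refl
*-^ a b (suc h) = trans (cong (a * b *_) (*-^ a b h))
  (solve 4 (λ a b x y → a :* b :* (x :* y) := a :* x :* (b :* y)) refl a b (a ^ h) (b ^ h))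
  where open +-*-Solver

-- For `n ≥ 1`, `suc n ≤ 2 * n`, which costs the factor `2 ^ h`.
≼⇒∈O* : ∀ {f g} → f ≼ g → f ∈O* g
≼⇒∈O* {f} {g} (bounded c h f≤) = h , c * 2 ^ h , 1 , λ n 1≤n → begin
  f n                              ≤⟨ f≤ n ⟩
  c * (g n * suc n ^ h)            ≤⟨ *-monoʳ-≤ c (*-monoʳ-≤ (g n) (^-monoˡ-≤ h (suc≤2* n 1≤n))) ⟩
  c * (g n * (2 * n) ^ h)          ≡⟨ cong (λ e → c * (g n * e)) (*-^ 2 n h) ⟩
  c * (g n * (2 ^ h * n ^ h))      ≡⟨ solve 4 (λ c a b d → c :* (a :* (b :* d)) := c :* b :* (a :* d)) refl c (g n) (2 ^ h) (n ^ h) ⟩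
  c * 2 ^ h * (g n * n ^ h)        ∎
  where
  open ≤-Reasoning
  open +-*-Solver
  suc≤2* : ∀ n → 1 ≤ n → suc n ≤ 2 * n
  suc≤2* n 1≤n = ≤-trans (≤-reflexive (+-comm 1 n)) (+-monoʳ-≤ n (≤-trans 1≤n (≤-reflexive (sym (+-identityʳ n)))))

-- The concrete program, its constants and its bounds

registers : ℕ
registers = 5 + (temps (inputLength {0}) + (temps (reachCount {0}) + (temps reachValE + (temps (rankCount {0}) + (temps rankValE + temps lastCell)))))

open Compile registers using (program; module Cost)

cycleRankProgram : Program
cycleRankProgram = record { extra = registers ; code = program reachCount reachValE rankCount rankValE }

-- The memory length has four summands, each at most `2 ^ (3 * n)`; hence `2 + 3 * n`. The same
-- exponent bounds all cell contents.
logSize : ℕ → ℕ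
logSize n = 2 + 3 * n

-- As in `registers`, a sum replaces the maximum, so that each single bound is just a summand.
logValue : ℕ → ℕ
logValue n = w (inputLength {0}) + (w (reachCount {0}) + (w reachValE + (w (rankCount {0}) + (w rankValE + (w lastCell + logSize n)))))
  where
  w : ∀ {m} → Exp m → ℕ
  w = width n (logSize n)

memoryLength : ℕ → ℕ
memoryLength n = suc (n * n) + 2 ^ n * n * n + 2 ^ n

totalSteps : ℕ → ℕ
totalSteps n =
  1 + (1 + (steps n (inputLength {0}) + 2 +
    (steps n (reachCount {0}) + 2 + (2 ^ n * n * n * suc (steps n reachValE + 3) + 1) +
    (steps n (rankCount {0}) + 2 + (2 ^ n * suc (steps n rankValE + 3) + 1) + (steps n lastCell + 2)))))

timeBound spaceBound : ℕ → ℕ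
timeBound  n = totalSteps n * (suc (logValue n) + suc (logValue n))
spaceBound n = suc registers * suc (logValue n) + memoryLength n * suc (logValue n)

1≤2^ : ∀ n → 1 ≤ 2 ^ n
1≤2^ = m^n>0 2

poly-logSize : Polynomial logSize
poly-logSize = ≼-+ (poly-const 2) (≼-* (poly-const 3) poly-n)

poly-logValue : Polynomial logValue
poly-logValue = w (inputLength {0}) (w (reachCount {0}) (w reachValE (w (rankCount {0}) (w rankValE (w lastCell poly-logSize)))))
  where
  w : ∀ {m f} (e : Exp m) → Polynomial f → Polynomial (λ n → width n (logSize n) e + f n)
  w e = ≼-+ (poly-width e poly-logSize)

2^n*n*n≼ : (λ n → 2 ^ n * n * n) ≼ (2 ^_)
2^n*n*n≼ = ≼-* {λ n → 2 ^ n * n} (≼-* ≼-refl poly-n) poly-n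

totalSteps≼ : totalSteps ≼ (2 ^_)
totalSteps≼ = ≼-+ (p (poly-const 1)) (≼-+ (p (poly-const 1)) (≼-+ (setup (inputLength {0}))
  (≼-+ (≼-+ (setup (reachCount {0})) (≼-+ (≼-* 2^n*n*n≼ (poly-suc (≼-+ (poly-steps reachValE) (poly-const 3)))) (p (poly-const 1))))
  (≼-+ (≼-+ (setup (rankCount {0})) (≼-+ (≼-* ≼-refl (poly-suc (≼-+ (poly-steps rankValE) (poly-const 3)))) (p (poly-const 1))))
    (setup lastCell)))))
  where
  p : ∀ {f} → Polynomial f → f ≼ (2 ^_)
  p = poly⇒≼ 1≤2^
  setup : ∀ {m} (e : Exp m) → (λ n → steps n e + 2) ≼ (2 ^_)
  setup e = p (≼-+ (poly-steps e) (poly-const 2))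

memoryLength≼ : memoryLength ≼ (2 ^_)
memoryLength≼ = ≼-+ (≼-+ (poly⇒≼ 1≤2^ (poly-suc (≼-* poly-n poly-n))) 2^n*n*n≼) ≼-refl

timeBound∈O* : timeBound ∈O* (2 ^_)
timeBound∈O* = ≼⇒∈O* (≼-* totalSteps≼ (≼-+ (poly-suc poly-logValue) (poly-suc poly-logValue)))

spaceBound∈O* : spaceBound ∈O* (2 ^_)
spaceBound∈O* = ≼⇒∈O* (≼-+ (poly⇒≼ 1≤2^ (≼-* (poly-const (suc registers)) (poly-suc poly-logValue)))
                           (≼-* memoryLength≼ (poly-suc poly-logValue)))

memoryLength≤ : ∀ n → memoryLength n ≤ 2 ^ logSize n
memoryLength≤ n = begin
  suc (n * n) + 2 ^ n * n * n + 2 ^ n   ≤⟨ +-mono-≤ (+-mono-≤ (+-mono-≤ 1≤P n*n≤P) (*-mono-≤ (*-monoʳ-≤ (2 ^ n) (m≤2^m n)) (m≤2^m n))) 2^n≤P ⟩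
  P + P + P + P                         ≡⟨ solve 1 (λ p → p :+ p :+ p :+ p := con 2 :* (con 2 :* p)) refl P ⟩
  2 * (2 * P)                           ≡⟨ cong (λ p → 2 * (2 * p)) P≡ ⟩
  2 ^ logSize n                         ∎
  where
  open ≤-Reasoning
  open +-*-Solver
  P : ℕ
  P = 2 ^ n * 2 ^ n * 2 ^ n
  P≡ : P ≡ 2 ^ (3 * n)
  P≡ = trans (solve 1 (λ x → x :* x :* x := x :^ 3) refl (2 ^ n)) (trans (^-*-assoc 2 n 3) (cong (2 ^_) (*-comm n 3)))
  2^n≤P : 2 ^ n ≤ P
  2^n≤P = ≤-trans (m≤n*m (2 ^ n) (2 ^ n * 2 ^ n) {{>-nonZero (*-mono-≤ (1≤2^ n) (1≤2^ n))}}) ≤-refl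
  1≤P : 1 ≤ P
  1≤P = ≤-trans (1≤2^ n) 2^n≤P
  n*n≤P : n * n ≤ P
  n*n≤P = ≤-trans (*-mono-≤ (m≤2^m n) (m≤2^m n)) (m≤m*n (2 ^ n * 2 ^ n) (2 ^ n) {{>-nonZero (1≤2^ n)}})

encode-bound : ∀ {n} (G : Digraph n) {b} → n ≤ b → 1 ≤ b → All (_≤ b) (encode G)
encode-bound {n} G {b} n≤b 1≤b = n≤b ∷ rows (allFin n)
  where
  entry : ∀ u v → encoded (G u v) ≤ b
  entry u v with G u v
  ... | true  = 1≤b
  ... | false = z≤n
  rows : ∀ us → All (_≤ b) (cartesianProductWith (λ u v → encoded (G u v)) us (allFin n))
  rows []       = []
  rows (u ∷ us) = ++⁺ (map⁺ (All.universal (entry u) (allFin n))) (rows us)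

-- The equation is there to be solved by `refl`: unfolding `e` determines `a`, which need not be
-- written out.
eval-sgE≤1 : ∀ {m} {a : Exp m} e → e ≡ sgE a → ∀ n M ρ → eval e n M ρ ≤ 1
eval-sgE≤1 {a = a} _ refl n M ρ = sg≤1 (eval a n M ρ)

eval-count≤n : ∀ {m} {a : Exp (suc m)} e → e ≡ ∑E (sgE a) → ∀ n M ρ → eval e n M ρ ≤ n
eval-count≤n {a = a} _ refl n M ρ = ∑≤n n _ λ t → eval-sgE≤1 (sgE a) refl n M (t ∷ ρ)

module _ {n} (G : Digraph n) where

  private
    q = logSize n
    W = logValue n
    w : ∀ {m} → Exp m → ℕ
    w = width n q

    t₅ = w lastCell + q
    t₄ = w rankValE + t₅
    t₃ = w (rankCount {0}) + t₄
    t₂ = w reachValE + t₃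
    t₁ = w (reachCount {0}) + t₂

    t₁≤W : t₁ ≤ W
    t₁≤W = m≤n+m t₁ (w (inputLength {0}))

    t₂≤W : t₂ ≤ W
    t₂≤W = ≤-trans (m≤n+m t₂ (w (reachCount {0}))) t₁≤W

    t₃≤W : t₃ ≤ W
    t₃≤W = ≤-trans (m≤n+m t₃ (w reachValE)) t₂≤W

    t₄≤W : t₄ ≤ W
    t₄≤W = ≤-trans (m≤n+m t₄ (w (rankCount {0}))) t₃≤W

    t₅≤W : t₅ ≤ W
    t₅≤W = ≤-trans (m≤n+m t₅ (w rankValE)) t₄≤W

  q≤W : q ≤ W
  q≤W = ≤-trans (m≤n+m q (w lastCell)) t₅≤W

  1≤2^q : 1 ≤ 2 ^ q
  1≤2^q = 1≤2^ q

  n≤2^q : n ≤ 2 ^ q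
  n≤2^q = ≤-trans (m≤2^m n) (^-monoʳ-≤ 2 (≤-trans (m≤n*m n 3) (m≤n+m (3 * n) 2)))

  module C = Cost q W (memoryLength n) q≤W
  open C.Correct n n≤2^q

  run-program : C.Exec (program reachCount reachValE rankCount rankValE) (initial (encode G)) (totalSteps n)
                  (λ t → reg t zero ≡ read (tables G) (length (tables G) ∸ 1))
  run-program = program-exec reachCount reachValE rankCount rankValE (2 ^ n * n * n) (2 ^ n)
    (cong (λ l → l + 2 ^ n * n * n + 2 ^ n) (sym (length-encode G))) (memoryLength≤ n)
    (length-encode G) refl (encode-bound G n≤2^q 1≤2^q)
    (λ M → cong (λ N → N * n * n) (pow≡ n ≤-refl)) (λ M → pow≡ n ≤-refl)
    (λ M ρ → ≤-trans (eval-sgE≤1 reachValE refl n M ρ) 1≤2^q)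
    (λ M ρ → ≤-trans (eval-count≤n rankValE refl n M ρ) n≤2^q)
    -- Register numbers do not depend on `n`, so these comparisons of closed numerals are decided by
    -- evaluation; the widths do, and are compared as summands.
    (≤ᵇ⇒≤ _ _ _) (m≤m+n (w (inputLength {0})) t₁)
    (≤ᵇ⇒≤ _ _ _) (≤-trans (m≤m+n (w (reachCount {0})) t₂) t₁≤W)
    (≤ᵇ⇒≤ _ _ _) (≤-trans (m≤m+n (w reachValE) t₃) t₂≤W)
    (≤ᵇ⇒≤ _ _ _) (≤-trans (m≤m+n (w (rankCount {0})) t₄) t₃≤W)
    (≤ᵇ⇒≤ _ _ _) (≤-trans (m≤m+n (w rankValE) t₅) t₄≤W)
    (≤ᵇ⇒≤ _ _ _) (≤-trans (m≤m+n (w lastCell) q) t₅≤W)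

theorem12 : Σ[ P ∈ Program ] ∃[ t ] ∃[ m ]
    t ∈O* (2 ^_) × m ∈O* (2 ^_) ×
    (∀ (n : ℕ) (G : Digraph n) →
    ∃[ r ] CycleRank G r × Computes P (encode G) r (t n) (m n))
theorem12 =
  cycleRankProgram , timeBound , spaceBound , timeBound∈O* , spaceBound∈O* ,
  λ n G → read (tables G) (length (tables G) ∸ 1) , tables-correct G , computes G (run-program G)
  where
  computes : ∀ {n r} (G : Digraph n) →
             C.Exec G (code cycleRankProgram) (initial (encode G)) (totalSteps n) (λ t → reg t zero ≡ r) →
             Computes cycleRankProgram (encode G) r (timeBound n) (spaceBound n)
  computes G (Cost.execution s r t≤ s≤ out) = record { final = s ; run = r ; correct = out ; inTime = t≤ ; inSpace = s≤ }
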